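{- For any integer $\gamma \geq 0$, the operad $\mathsf{Dias}_\gamma$ admits the following presentation. It is generated by $\mathfrak{G}'_\gamma := \{\bar\dashv_a, \bar\vdash_a : a \in [\gamma]\}$ and its space of relations is generated by the following elements: $$\bar\dashv_a \circ_1 \bar\vdash_{a'} - \bar\vdash_{a'} \circ_2 \bar\dashv_a, \qquad a, a' \in [\gamma];$$ for all $a < b \in [\gamma]$, $$\bar\vdash_b \circ_1 \bar\vdash_a, \qquad \bar\dashv_b \circ_2 \bar\dashv_a, \qquad \bar\vdash_b \circ_1 \bar\dashv_a, \qquad \bar\dashv_b \circ_2 \bar\vdash_a,$$ $$\bar\vdash_a \circ_1 \bar\vdash_b - \bar\vdash_b \circ_2 \bar\vdash_a, \qquad \bar\dashv_b \circ_1 \bar\dashv_a - \bar\dashv_a \circ_2 \bar\dashv_b,$$ $$\bar\vdash_a \circ_1 \bar\dashv_b - \bar\vdash_a \circ_2 \bar\vdash_b, \qquad \bar\dashv_a \circ_1 \bar\dashv_b - \bar\dashv_a \circ_2 \bar\vdash_b;$$ and for all $a \in [\gamma]$, $$\bar\vdash_a \circ_1 \bar\vdash_a - \Big(\sum_{a \leq b \in [\gamma]} \bar\vdash_a \circ_2 \bar\vdash_b\Big), \qquad \Big(\sum_{a \leq b \in [\gamma]} \bar\dashv_a \circ_1 \bar\dashv_b\Big) - \bar\dashv_a \circ_2 \bar\dashv_a,$$ $$\bar\vdash_a \circ_1 \bar\dashv_a - \Big(\sum_{a \leq b \in [\gamma]} \bar\vdash_b \circ_2 \bar\vdash_a\Big),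 \qquad \Big(\sum_{a \leq b \in [\gamma]} \bar\dashv_b \circ_1 \bar\dashv_a\Big) - \bar\dashv_a \circ_2 \bar\vdash_a.$$
   Context: The ground field has characteristic zero; $[\gamma]=\{1,\dots,\gamma\}$. $\mathsf{Dias}_\gamma$ is the nonsymmetric operad in vector spaces generated by the words $0a$, $a0$, $a \in [\gamma]$, inside the operad whose arity-$n$ component ($n\ge1$) has as basis all words of length $n$ on $\{0\}\cup[\gamma]$, with partial compositions $u \circ_i v := u_1 \dots u_{i-1}\,\max(u_i, v_1) \dots \max(u_i, v_m)\, u_{i+1} \dots u_n$ and unit the word $0$. $\mathbf{Free}(S)$ is the free nonsymmetric operad on a graded set $S$ (basis: planar rooted trees with internal nodes of arity $k$ labeled by arity-$k$ elements of $S$; $\mathfrak{s}\circ_i\mathfrak{t}$ grafts $\mathfrak{t}$ on the $i$th leaf of $\mathfrak{s}$); elements of $S$ are identified with trees with one internal node. Let $\mathfrak{G}_\gamma := \{\dashv_a, \vdash_a : a \in [\gamma]\}$, all of arity $2$, where $\dashv_a$ corresponds to the word $0a$ and $\vdash_a$ to the word $a0$. In $\mathbf{Free}(\mathfrak{G}_\gamma)(2)$ define, for $a \in [\gamma]$, $\bar\dashv_a := \dashv_\gamma$ if $a = \gamma$ and $\bar\dashv_a := \dashv_a - \dashv_{a+1}$ otherwise; $\bar\vdash_a := \vdash_\gamma$ if $a = \gamma$ and $\bar\vdash_a := \vdash_a - \vdash_{a+1}$ otherwise. The family $\mathfrak{G}'_\gamma$ of these elements is a basis of $\mathbf{Free}(\mathfrak{G}_\gamma)(2)$,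 so $\mathbf{Free}(\mathfrak{G}'_\gamma)$ is identified with $\mathbf{Free}(\mathfrak{G}_\gamma)$. Saying that an operad $\mathcal{O}$ admits the presentation with generators $\mathfrak{G}$ and space of relations $\mathfrak{R} \subseteq \mathbf{Free}(\mathfrak{G})$ means $\mathcal{O} \cong \mathbf{Free}(\mathfrak{G})/\langle\mathfrak{R}\rangle$, where $\langle\mathfrak{R}\rangle$ is the operad ideal generated by $\mathfrak{R}$. -}

module Defs where

open import Level using (Level; _⊔_) renaming (suc to lsuc)
open import Algebra.Bundles using (CommutativeMonoid; CommutativeRing)
open import Algebra.Apartness.Bundles using (HeytingCommutativeRing; HeytingField)
open import Algebra.Definitions.RawMonoid using (_×_)
open import Algebra.Module.Bundles using (Module)
open import Algebra.Module.Morphism.Structures using (module ModuleMorphisms)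
open import Algebra.Module.Structures.Biased using (IsModuleFromLeft)
open import Algebra.Module.Structures using (IsModule)
import Algebra.Construct.NaturalChoice.Max as Max
import Algebra.Properties.AbelianGroup as AbelianGroupProperties
import Algebra.Properties.CommutativeSemigroup as CommutativeSemigroupProperties
open import Data.Fin.Base as Fin using (Fin; zero; suc; toℕ; fromℕ<)
import Data.Fin.Properties as Fin
open import Data.List.Base
  using (List; []; _∷_; _++_; map; length; foldr; filter; allFin)
open import Data.List.Properties using (length-++; length-map; ++-assoc; ++-identityʳ; map-++; map-cong; map-∘; map-id)
open import Data.Nat.Base as ℕ using (ℕ; zero; suc; _+_; _∸_; _<_; _≤_; z≤n; s≤s)
import Data.Nat.Properties as ℕ
open import Data.Product.Base using (Σ; _,_; proj₁; proj₂; Σ-syntax)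
open import Relation.Binary.Core using (Rel)
open import Relation.Binary.Structures using (IsEquivalence)
open import Relation.Binary.PropositionalEquality as ≡
  using (_≡_; refl; cong; cong₂; subst; subst₂)
import Relation.Binary.Reasoning.Setoid as SetoidReasoning
open import Relation.Nullary using (¬_; yes; no; contradiction)

private
  variable
    r ℓr a m m′ ℓm ℓm′ p g : Level

fieldRing : ∀ {c ℓ₁ ℓ₂} → HeytingField c ℓ₁ ℓ₂ → CommutativeRing c ℓ₁
fieldRing K =
  HeytingCommutativeRing.commutativeRing (HeytingField.heytingCommutativeRing K)

CharacteristicZero : CommutativeRing r ℓr → Set ℓr
CharacteristicZero R = ∀ n → ¬ (_×_ +-rawMonoid (suc n) 1# ≈ 0#)
  where open CommutativeRing R

-- Positions count from 0; x ∘[ i ] y is unconstrained, and never used, for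
-- i ≥ arity x.
record SetOperad : Set₁ where
  infixl 8 _∘[_]_
  field
    El       : Set
    arity    : El → ℕ
    one      : El
    _∘[_]_   : El → ℕ → El → El
    arity-one  : arity one ≡ 1
    arity-∘  : ∀ x {i} y → i < arity x → suc (arity (x ∘[ i ] y)) ≡ arity x + arity y
    identityˡ : ∀ x → one ∘[ 0 ] x ≡ x
    identityʳ : ∀ x {i} → i < arity x → x ∘[ i ] one ≡ x
    sequential : ∀ x y z {i j} → i < arity x → j < arity y →
                 (x ∘[ i ] y) ∘[ i + j ] z ≡ x ∘[ i ] (y ∘[ j ] z)
    parallel : ∀ x y z {i j j′} → i < j → j < arity x → suc j′ ≡ j + arity y →
               (x ∘[ i ] y) ∘[ j′ ] z ≡ (x ∘[ j ] z) ∘[ i ] y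

  OfArity : ℕ → Set
  OfArity n = Σ[ x ∈ El ] arity x ≡ n

module Words (γ : ℕ) where
  open Max (Fin.≤-totalOrder (suc γ)) using (x≤y⇒x⊔y≈y; x≤y⇒y⊔x≈y; ⊔-assoc) renaming (_⊔_ to max)

  Letter : Set
  Letter = Fin (suc γ)

  substitute : List Letter → ℕ → List Letter → List Letter
  substitute []      _       v = []
  substitute (x ∷ u) zero    v = map (max x) v ++ u
  substitute (x ∷ u) (suc i) v = x ∷ substitute u i v

  private
    length-substitute : ∀ u {i} v → i < length u →
                        suc (length (substitute u i v)) ≡ length u + length v
    length-substitute (x ∷ u) {zero} v _ = cong suc (begin
      length (map (max x) v ++ u)        ≡⟨ length-++ (map (max x) v) ⟩
      length (map (max x) v) + length u  ≡⟨ cong (_+ length u) (length-map (max x) v) ⟩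
      length v + length u                ≡⟨ ℕ.+-comm (length v) _ ⟩
      length u + length v                ∎)
      where open ≡.≡-Reasoning
    length-substitute (x ∷ u) {suc i} v (s≤s i<) = cong suc (length-substitute u v i<)

    substitute-++ˡ : ∀ u w {i} v → i < length u →
                     substitute (u ++ w) i v ≡ substitute u i v ++ w
    substitute-++ˡ (x ∷ u) w {zero}  v _        = ≡.sym (++-assoc (map (max x) v) u w)
    substitute-++ˡ (x ∷ u) w {suc i} v (s≤s i<) = cong (x ∷_) (substitute-++ˡ u w v i<)

    substitute-++ʳ : ∀ u w i v →
                     substitute (u ++ w) (length u + i) v ≡ u ++ substitute w i v
    substitute-++ʳ []      w i v = refl
    substitute-++ʳ (x ∷ u) w i v = cong (x ∷_) (substitute-++ʳ u w i v)

    map-max-max : ∀ x y v → map (max (max x y)) v ≡ map (max x) (map (max y) v)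
    map-max-max x y v = ≡.trans (map-cong (⊔-assoc x y) v) (map-∘ v)

    substitute-map : ∀ x u i v → substitute (map (max x) u) i v ≡ map (max x) (substitute u i v)
    substitute-map x []      i       v = refl
    substitute-map x (y ∷ u) zero    v = ≡.trans
      (cong (_++ map (max x) u) (map-max-max x y v))
      (≡.sym (map-++ (max x) (map (max y) v) u))
    substitute-map x (y ∷ u) (suc i) v = cong (max x y ∷_) (substitute-map x u i v)

    unitˡ : ∀ u → map (max zero) u ++ [] ≡ u
    unitˡ u = ≡.trans (++-identityʳ _)
      (≡.trans (map-cong (λ y → x≤y⇒x⊔y≈y {y} {zero} z≤n) u) (map-id u))

    unitʳ : ∀ u {i} → i < length u → substitute u i (zero ∷ []) ≡ u
    unitʳ (x ∷ u) {zero}  _        = cong (_∷ u) (x≤y⇒y⊔x≈y {x} {zero} z≤n)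
    unitʳ (x ∷ u) {suc i} (s≤s i<) = cong (x ∷_) (unitʳ u i<)

    seq : ∀ u v w {i j} → i < length u → j < length v →
          substitute (substitute u i v) (i + j) w ≡ substitute u i (substitute v j w)
    seq (x ∷ u) v w {zero}  {j} _ j< = ≡.trans
      (substitute-++ˡ (map (max x) v) u w (subst (j <_) (≡.sym (length-map (max x) v)) j<))
      (cong (_++ u) (substitute-map x v j w))
    seq (x ∷ u) v w {suc i} (s≤s i<) j< = cong (x ∷_) (seq u v w i< j<)

    par : ∀ u v w {i j j′} → i < j → j < length u → suc j′ ≡ j + length v →
          substitute (substitute u i v) j′ w ≡ substitute (substitute u j w) i v
    par (x ∷ u) v w {zero} {suc j} {j′} _ _ eq = begin
      substitute (map (max x) v ++ u) j′ w ≡⟨ cong (λ n → substitute (map (max x) v ++ u) n w) j′≡ ⟩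
      substitute (map (max x) v ++ u) (length (map (max x) v) + j) w
                                          ≡⟨ substitute-++ʳ (map (max x) v) u j w ⟩
      map (max x) v ++ substitute u j w   ∎
      where
      open ≡.≡-Reasoning
      j′≡ : j′ ≡ length (map (max x) v) + j
      j′≡ = ≡.trans (ℕ.suc-injective eq)
        (≡.trans (ℕ.+-comm j _) (cong (_+ j) (≡.sym (length-map (max x) v))))
    par (x ∷ u) v w {suc i} {suc (suc j)} {zero} (s≤s i<j) (s≤s j<) ()
    par (x ∷ u) v w {suc i} {suc j} {suc j′} (s≤s i<j) (s≤s j<) eq =
      cong (x ∷_) (par u v w i<j j< (ℕ.suc-injective eq))

  wordOperad : SetOperad
  wordOperad = record
    { El = List Letter ; arity = length ; one = zero ∷ [] ; _∘[_]_ = substitute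
    ; arity-one = refl ; arity-∘ = λ u v → length-substitute u v
    ; identityˡ = unitˡ ; identityʳ = unitʳ ; sequential = seq ; parallel = par }

-- All generators considered here are binary, so every internal node has two children.
module Trees (S : Set) where
  data Tree : Set where
    leaf : Tree
    node : S → Tree → Tree → Tree

  leaves : Tree → ℕ
  leaves leaf         = 1
  leaves (node s t u) = leaves t + leaves u

  graft : Tree → ℕ → Tree → Tree
  graft leaf i v = v
  graft (node s t u) i v with i ℕ.<? leaves t
  ... | yes _ = node s (graft t i v) u
  ... | no  _ = node s t (graft u (i ∸ leaves t) v)

  private
    graft-left : ∀ s t u {i} v → i < leaves t →
                 graft (node s t u) i v ≡ node s (graft t i v) u
    graft-left s t u {i} v i< with i ℕ.<? leaves t
    ... | yes _ = refl
    ... | no i≮ = contradiction i< i≮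

    graft-right : ∀ s t u i v →
                  graft (node s t u) (leaves t + i) v ≡ node s t (graft u i v)
    graft-right s t u i v with leaves t + i ℕ.<? leaves t
    ... | yes p = contradiction p (ℕ.m+n≮m (leaves t) i)
    ... | no _ = cong (λ n → node s t (graft u n v)) (ℕ.m+n∸m≡n (leaves t) i)

    data Position (m n : ℕ) : ℕ → Set where
      left  : ∀ {i} → i < m → Position m n i
      right : ∀ {i} → i < n → Position m n (m + i)

    position : ∀ m n {i} → i < m + n → Position m n i
    position m n {i} i< with i ℕ.<? m
    ... | yes p = left p
    ... | no ¬p = subst (Position m n) (ℕ.m+[n∸m]≡n m≤i) (right i∸m<n)
      where
      m≤i : m ≤ i
      m≤i = ℕ.≮⇒≥ ¬p
      i∸m<n : i ∸ m < n
      i∸m<n = ℕ.+-cancelˡ-< m _ _ (subst (_< m + n) (≡.sym (ℕ.m+[n∸m]≡n m≤i)) i<)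

    leaves-graft : ∀ t {i} v → i < leaves t → suc (leaves (graft t i v)) ≡ leaves t + leaves v
    leaves-graft leaf v _ = refl
    leaves-graft (node s t u) {i} v i< with position (leaves t) (leaves u) i<
    ... | left p = begin
      suc (leaves (graft (node s t u) i v))   ≡⟨ cong (λ x → suc (leaves x)) (graft-left s t u v p) ⟩
      suc (leaves (graft t i v)) + leaves u   ≡⟨ cong (_+ leaves u) (leaves-graft t v p) ⟩
      leaves t + leaves v + leaves u          ≡⟨ ℕ.+-assoc (leaves t) _ _ ⟩
      leaves t + (leaves v + leaves u)        ≡⟨ cong (leaves t +_) (ℕ.+-comm (leaves v) _) ⟩
      leaves t + (leaves u + leaves v)        ≡⟨ ℕ.+-assoc (leaves t) _ _ ⟨
      leaves t + leaves u + leaves v          ∎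
      where open ≡.≡-Reasoning
    ... | right {j} p = begin
      suc (leaves (graft (node s t u) (leaves t + j) v))
                                              ≡⟨ cong (λ x → suc (leaves x)) (graft-right s t u j v) ⟩
      suc (leaves t + leaves (graft u j v))   ≡⟨ ℕ.+-suc (leaves t) _ ⟨
      leaves t + suc (leaves (graft u j v))   ≡⟨ cong (leaves t +_) (leaves-graft u v p) ⟩
      leaves t + (leaves u + leaves v)        ≡⟨ ℕ.+-assoc (leaves t) _ _ ⟨
      leaves t + leaves u + leaves v          ∎
      where open ≡.≡-Reasoning

    unitʳ : ∀ t {i} → i < leaves t → graft t i leaf ≡ t
    unitʳ leaf _ = refl
    unitʳ (node s t u) i< with position (leaves t) (leaves u) i<
    ... | left p      = ≡.trans (graft-left s t u leaf p) (cong (λ x → node s x u) (unitʳ t p))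
    ... | right {j} p = ≡.trans (graft-right s t u j leaf) (cong (node s t) (unitʳ u p))

    shift-< : ∀ {t i j} v → i < leaves t → j < leaves v → i + j < leaves (graft t i v)
    shift-< {t} {i} {j} v i< j< = ℕ.≤-pred (begin-strict
      suc (i + j)                  ≡⟨ ℕ.+-suc i j ⟨
      i + suc j                    <⟨ ℕ.+-mono-<-≤ i< j< ⟩
      leaves t + leaves v          ≡⟨ leaves-graft t v i< ⟨
      suc (leaves (graft t i v))   ∎)
      where open ℕ.≤-Reasoning

    seq : ∀ t v w {i j} → i < leaves t → j < leaves v →
          graft (graft t i v) (i + j) w ≡ graft t i (graft v j w)
    seq leaf v w {zero} _ _ = refl
    seq leaf v w {suc i} (s≤s ()) _
    seq (node s t u) v w {i} {j} i< j< with position (leaves t) (leaves u) i<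
    ... | left p = begin
      graft (graft (node s t u) i v) (i + j) w    ≡⟨ cong (λ x → graft x (i + j) w) (graft-left s t u v p) ⟩
      graft (node s (graft t i v) u) (i + j) w    ≡⟨ graft-left s _ u w (shift-< {t} v p j<) ⟩
      node s (graft (graft t i v) (i + j) w) u    ≡⟨ cong (λ x → node s x u) (seq t v w p j<) ⟩
      node s (graft t i (graft v j w)) u          ≡⟨ graft-left s t u _ p ⟨
      graft (node s t u) i (graft v j w)          ∎
      where open ≡.≡-Reasoning
    ... | right {k} p = begin
      graft (graft (node s t u) (leaves t + k) v) (leaves t + k + j) w
        ≡⟨ cong₂ (λ x n → graft x n w) (graft-right s t u k v) (ℕ.+-assoc (leaves t) k j) ⟩
      graft (node s t (graft u k v)) (leaves t + (k + j)) w
        ≡⟨ graft-right s t _ (k + j) w ⟩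
      node s t (graft (graft u k v) (k + j) w)
        ≡⟨ cong (node s t) (seq u v w p j<) ⟩
      node s t (graft u k (graft v j w))
        ≡⟨ graft-right s t u k _ ⟨
      graft (node s t u) (leaves t + k) (graft v j w) ∎
      where open ≡.≡-Reasoning

    par : ∀ t v w {i j j′} → i < j → j < leaves t → suc j′ ≡ j + leaves v →
          graft (graft t i v) j′ w ≡ graft (graft t j w) i v
    par leaf v w {j = suc j} _ (s≤s ()) _
    par (node s t u) v w {i} {j} {j′} i<j j< eq
      with position (leaves t) (leaves u) (ℕ.<-trans i<j j<) | position (leaves t) (leaves u) j<
    ... | left p | left q = begin
      graft (graft (node s t u) i v) j′ w    ≡⟨ cong (λ x → graft x j′ w) (graft-left s t u v p) ⟩
      graft (node s (graft t i v) u) j′ w    ≡⟨ graft-left s _ u w j′< ⟩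
      node s (graft (graft t i v) j′ w) u    ≡⟨ cong (λ x → node s x u) (par t v w i<j q eq) ⟩
      node s (graft (graft t j w) i v) u     ≡⟨ graft-left s _ u v i<′ ⟨
      graft (node s (graft t j w) u) i v     ≡⟨ cong (λ x → graft x i v) (graft-left s t u w q) ⟨
      graft (graft (node s t u) j w) i v     ∎
      where
      open ≡.≡-Reasoning
      j′< : j′ < leaves (graft t i v)
      j′< = ℕ.≤-pred (subst₂ _<_ (≡.sym eq) (≡.sym (leaves-graft t v p))
                       (ℕ.+-monoˡ-< (leaves v) q))
      i<′ : i < leaves (graft t j w)
      i<′ = ℕ.<-≤-trans i<j (ℕ.≤-pred (subst (suc j ≤_) (≡.sym (leaves-graft t w q))
                       (ℕ.≤-trans q (ℕ.m≤m+n _ _))))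
    ... | left p | right {k} q = begin
      graft (graft (node s t u) i v) j′ w
        ≡⟨ cong₂ (λ x n → graft x n w) (graft-left s t u v p) j′≡ ⟩
      graft (node s (graft t i v) u) (leaves (graft t i v) + k) w
        ≡⟨ graft-right s _ u k w ⟩
      node s (graft t i v) (graft u k w)
        ≡⟨ graft-left s t _ v p ⟨
      graft (node s t (graft u k w)) i v
        ≡⟨ cong (λ x → graft x i v) (graft-right s t u k w) ⟨
      graft (graft (node s t u) (leaves t + k) w) i v ∎
      where
      open ≡.≡-Reasoning
      j′≡ : j′ ≡ leaves (graft t i v) + k
      j′≡ = ℕ.suc-injective (begin
        suc j′                          ≡⟨ eq ⟩
        leaves t + k + leaves v         ≡⟨ ℕ.+-assoc (leaves t) k _ ⟩
        leaves t + (k + leaves v)       ≡⟨ cong (leaves t +_) (ℕ.+-comm k _) ⟩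
        leaves t + (leaves v + k)       ≡⟨ ℕ.+-assoc (leaves t) _ k ⟨
        leaves t + leaves v + k         ≡⟨ cong (_+ k) (leaves-graft t v p) ⟨
        suc (leaves (graft t i v)) + k  ∎)
    ... | right {h} p | left q =
      contradiction (ℕ.<-trans i<j q) (ℕ.m+n≮m (leaves t) h)
    ... | right {h} p | right {k} q = begin
      graft (graft (node s t u) (leaves t + h) v) j′ w
        ≡⟨ cong₂ (λ x n → graft x n w) (graft-right s t u h v) j′≡ ⟩
      graft (node s t (graft u h v)) (leaves t + ℕ.pred (k + leaves v)) w
        ≡⟨ graft-right s t _ _ w ⟩
      node s t (graft (graft u h v) (ℕ.pred (k + leaves v)) w)
        ≡⟨ cong (node s t) (par u v w h<k q sucpred) ⟩
      node s t (graft (graft u k w) h v)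
        ≡⟨ graft-right s t _ h v ⟨
      graft (node s t (graft u k w)) (leaves t + h) v
        ≡⟨ cong (λ x → graft x (leaves t + h) v) (graft-right s t u k w) ⟨
      graft (graft (node s t u) (leaves t + k) w) (leaves t + h) v ∎
      where
      open ≡.≡-Reasoning
      h<k : h < k
      h<k = ℕ.+-cancelˡ-< (leaves t) h k i<j
      sucpred : suc (ℕ.pred (k + leaves v)) ≡ k + leaves v
      sucpred = ℕ.suc-pred _ ⦃ ℕ.>-nonZero (ℕ.<-≤-trans (ℕ.m<n⇒0<n h<k) (ℕ.m≤m+n k _)) ⦄
      j′≡ : j′ ≡ leaves t + ℕ.pred (k + leaves v)
      j′≡ = ℕ.suc-injective (begin
        suc j′                                   ≡⟨ eq ⟩
        leaves t + k + leaves v                  ≡⟨ ℕ.+-assoc (leaves t) k _ ⟩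
        leaves t + (k + leaves v)                ≡⟨ cong (leaves t +_) sucpred ⟨
        leaves t + suc (ℕ.pred (k + leaves v))   ≡⟨ ℕ.+-suc (leaves t) _ ⟩
        suc (leaves t + ℕ.pred (k + leaves v))   ∎)

  treeOperad : SetOperad
  treeOperad = record
    { El = Tree ; arity = leaves ; one = leaf ; _∘[_]_ = graft
    ; arity-one = refl ; arity-∘ = λ t v → leaves-graft t v
    ; identityˡ = λ _ → refl ; identityʳ = unitʳ ; sequential = seq ; parallel = par }

module _ (R : CommutativeRing r ℓr) where
  open CommutativeRing R using (_≈_; _*_; 0#; 1#) renaming (Carrier to K; _+_ to _+ᴷ_)

  record ModuleLaws {A : Set a} (_≈ᴹ_ : Rel A ℓm) (_+ᴹ_ : A → A → A) (0ᴹ : A)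
                    (-ᴹ_ : A → A) (_*ₗ_ : K → A → A) : Set (r ⊔ ℓr ⊔ a ⊔ ℓm) where
    field
      isEquivalence : IsEquivalence _≈ᴹ_
      +-cong        : ∀ {x x′ y y′} → x ≈ᴹ x′ → y ≈ᴹ y′ → (x +ᴹ y) ≈ᴹ (x′ +ᴹ y′)
      +-assoc       : ∀ x y z → ((x +ᴹ y) +ᴹ z) ≈ᴹ (x +ᴹ (y +ᴹ z))
      +-comm        : ∀ x y → (x +ᴹ y) ≈ᴹ (y +ᴹ x)
      +-identityˡ   : ∀ x → (0ᴹ +ᴹ x) ≈ᴹ x
      -‿cong        : ∀ {x y} → x ≈ᴹ y → (-ᴹ x) ≈ᴹ (-ᴹ y)
      -‿inverseˡ    : ∀ x → ((-ᴹ x) +ᴹ x) ≈ᴹ 0ᴹ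
      *-cong        : ∀ {s t x y} → s ≈ t → x ≈ᴹ y → (s *ₗ x) ≈ᴹ (t *ₗ y)
      *-zeroˡ       : ∀ x → (0# *ₗ x) ≈ᴹ 0ᴹ
      *-zeroʳ       : ∀ s → (s *ₗ 0ᴹ) ≈ᴹ 0ᴹ
      *-identityˡ   : ∀ x → (1# *ₗ x) ≈ᴹ x
      *-assoc       : ∀ s t x → ((s * t) *ₗ x) ≈ᴹ (s *ₗ (t *ₗ x))
      *-distribʳ    : ∀ x s t → ((s +ᴷ t) *ₗ x) ≈ᴹ ((s *ₗ x) +ᴹ (t *ₗ x))
      *-distribˡ    : ∀ s x y → (s *ₗ (x +ᴹ y)) ≈ᴹ ((s *ₗ x) +ᴹ (s *ₗ y))

    private
      trans : ∀ {x y z} → x ≈ᴹ y → y ≈ᴹ z → x ≈ᴹ z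
      trans = IsEquivalence.trans isEquivalence

    isModule : IsModule R _≈ᴹ_ _+ᴹ_ 0ᴹ -ᴹ_ _*ₗ_ (λ x s → s *ₗ x)
    isModule = IsModuleFromLeft.isModule {commutativeRing = R} (record
        { isLeftModule = record
          { isLeftSemimodule = record
            { +ᴹ-isCommutativeMonoid = record
              { isMonoid = record
                { isSemigroup = record
                  { isMagma = record { isEquivalence = isEquivalence ; ∙-cong = +-cong }
                  ; assoc   = +-assoc }
                ; identity = +-identityˡ , λ x → trans (+-comm x 0ᴹ) (+-identityˡ x) }
              ; comm = +-comm }
            ; isPreleftSemimodule = record
              { *ₗ-cong      = *-cong
              ; *ₗ-zeroˡ     = *-zeroˡ
              ; *ₗ-distribʳ  = *-distribʳ
              ; *ₗ-identityˡ = *-identityˡ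
              ; *ₗ-assoc     = *-assoc
              ; *ₗ-zeroʳ     = *-zeroʳ
              ; *ₗ-distribˡ  = *-distribˡ } }
          ; -ᴹ‿cong    = -‿cong
          ; -ᴹ‿inverse = -‿inverseˡ , λ x → trans (+-comm x (-ᴹ x)) (-‿inverseˡ x) } })

  module _ (M : Module R m ℓm) where
    open Module M

    record IsSubmodule (P : Carrierᴹ → Set p) : Set (r ⊔ m ⊔ ℓm ⊔ p) where
      field
        resp : ∀ {x y} → x ≈ᴹ y → P x → P y
        0∈   : P 0ᴹ
        +∈   : ∀ {x y} → P x → P y → P (x +ᴹ y)
        *∈   : ∀ s {x} → P x → P (s *ₗ x)

      private
        module G = AbelianGroupProperties +ᴹ-abelianGroup
        m1 : K
        m1 = CommutativeRing.-_ R 1#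

      neg-scale : ∀ x → m1 *ₗ x ≈ᴹ -ᴹ x
      neg-scale x = G.inverseˡ-unique _ x (begin
        (m1 *ₗ x) +ᴹ x          ≈⟨ +ᴹ-congˡ (*ₗ-identityˡ x) ⟨
        (m1 *ₗ x) +ᴹ (1# *ₗ x)  ≈⟨ *ₗ-distribʳ x m1 1# ⟨
        (m1 +ᴷ 1#) *ₗ x         ≈⟨ *ₗ-congʳ (CommutativeRing.-‿inverseˡ R 1#) ⟩
        0# *ₗ x                 ≈⟨ *ₗ-zeroˡ x ⟩
        0ᴹ                      ∎)
        where open SetoidReasoning ≈ᴹ-setoid

      -∈ : ∀ {x} → P x → P (-ᴹ x)
      -∈ {x} px = resp (neg-scale x) (*∈ _ px)

    module _ {P : Carrierᴹ → Set p} (isSub : IsSubmodule P) where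
      open IsSubmodule isSub

      submodule : Module R (m ⊔ p) ℓm
      submodule .Module.Carrierᴹ = Σ Carrierᴹ P
      submodule .Module._≈ᴹ_ (x , _) (y , _) = x ≈ᴹ y
      submodule .Module._+ᴹ_ (x , p) (y , q) = x +ᴹ y , +∈ p q
      submodule .Module._*ₗ_ s (x , p) = s *ₗ x , *∈ s p
      submodule .Module._*ᵣ_ (x , p) s = s *ₗ x , *∈ s p
      submodule .Module.0ᴹ = 0ᴹ , 0∈
      submodule .Module.-ᴹ_ (x , p) = -ᴹ x , -∈ p
      submodule .Module.isModule = ModuleLaws.isModule record
        { isEquivalence = record { refl = ≈ᴹ-refl ; sym = ≈ᴹ-sym ; trans = ≈ᴹ-trans }
        ; +-cong = +ᴹ-cong ; +-assoc = λ x y z → +ᴹ-assoc _ _ _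
        ; +-comm = λ x y → +ᴹ-comm _ _ ; +-identityˡ = λ x → +ᴹ-identityˡ _
        ; -‿cong = -ᴹ‿cong ; -‿inverseˡ = λ x → -ᴹ‿inverseˡ _
        ; *-cong = *ₗ-cong ; *-zeroˡ = λ x → *ₗ-zeroˡ _ ; *-zeroʳ = *ₗ-zeroʳ
        ; *-identityˡ = λ x → *ₗ-identityˡ _ ; *-assoc = λ s t x → *ₗ-assoc s t _
        ; *-distribʳ = λ x s t → *ₗ-distribʳ _ s t
        ; *-distribˡ = λ s x y → *ₗ-distribˡ s _ _ }

      private
        module G = AbelianGroupProperties +ᴹ-abelianGroup
        infixl 6 _-_
        _-_ : Carrierᴹ → Carrierᴹ → Carrierᴹ
        x - y = x +ᴹ -ᴹ y
        open SetoidReasoning ≈ᴹ-setoid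

        open CommutativeSemigroupProperties
          (CommutativeMonoid.commutativeSemigroup +ᴹ-commutativeMonoid) using (interchange)

        neg-+ : ∀ x y → -ᴹ (x +ᴹ y) ≈ᴹ -ᴹ x +ᴹ -ᴹ y
        neg-+ x y = ≈ᴹ-sym (G.⁻¹-∙-comm x y)

        neg-* : ∀ s x → s *ₗ -ᴹ x ≈ᴹ -ᴹ (s *ₗ x)
        neg-* s x = G.inverseˡ-unique _ _ (begin
          s *ₗ -ᴹ x +ᴹ s *ₗ x  ≈⟨ *ₗ-distribˡ s _ x ⟨
          s *ₗ (-ᴹ x +ᴹ x)     ≈⟨ *ₗ-cong (CommutativeRing.refl R) (-ᴹ‿inverseˡ x) ⟩
          s *ₗ 0ᴹ              ≈⟨ *ₗ-zeroʳ s ⟩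
          0ᴹ                   ∎)

        telescope : ∀ x y z → (x - y) +ᴹ (y - z) ≈ᴹ x - z
        telescope x y z = begin
          (x - y) +ᴹ (y - z)          ≈⟨ +ᴹ-assoc x _ _ ⟩
          x +ᴹ (-ᴹ y +ᴹ (y - z))      ≈⟨ +ᴹ-congˡ (+ᴹ-assoc _ y _) ⟨
          x +ᴹ ((-ᴹ y +ᴹ y) +ᴹ -ᴹ z)  ≈⟨ +ᴹ-congˡ (+ᴹ-congʳ (-ᴹ‿inverseˡ y)) ⟩
          x +ᴹ (0ᴹ +ᴹ -ᴹ z)           ≈⟨ +ᴹ-congˡ (+ᴹ-identityˡ _) ⟩
          x - z                       ∎

        flip- : ∀ x y → -ᴹ (x - y) ≈ᴹ y - x
        flip- x y = begin
          -ᴹ (x - y)           ≈⟨ neg-+ x _ ⟩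
          -ᴹ x +ᴹ -ᴹ (-ᴹ y)    ≈⟨ +ᴹ-congˡ (G.⁻¹-involutive y) ⟩
          -ᴹ x +ᴹ y            ≈⟨ +ᴹ-comm _ y ⟩
          y - x                ∎

      infix 4 _~_
      _~_ : Carrierᴹ → Carrierᴹ → Set p
      x ~ y = P (x - y)

      ≈⇒~ : ∀ {x y} → x ≈ᴹ y → x ~ y
      ≈⇒~ {x} {y} x≈y = resp (≈ᴹ-sym (≈ᴹ-trans (+ᴹ-congʳ x≈y) (-ᴹ‿inverseʳ y))) 0∈

      ~-trans : ∀ {x y z} → x ~ y → y ~ z → x ~ z
      ~-trans {x} {y} {z} p q = resp (telescope x y z) (+∈ p q)

      ~-sym : ∀ {x y} → x ~ y → y ~ x
      ~-sym {x} {y} p = resp (flip- x y) (-∈ p)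

      quotientModule : Module R m p
      quotientModule .Module.Carrierᴹ = Carrierᴹ
      quotientModule .Module._≈ᴹ_ = _~_
      quotientModule .Module._+ᴹ_ = _+ᴹ_
      quotientModule .Module._*ₗ_ = _*ₗ_
      quotientModule .Module._*ᵣ_ x s = s *ₗ x
      quotientModule .Module.0ᴹ = 0ᴹ
      quotientModule .Module.-ᴹ_ = -ᴹ_
      quotientModule .Module.isModule = ModuleLaws.isModule record
        { isEquivalence = record { refl = ≈⇒~ ≈ᴹ-refl ; sym = ~-sym ; trans = ~-trans }
        ; +-cong = λ {x} {x′} {y} {y′} p q →
            resp (≈ᴹ-trans (interchange x _ y _) (+ᴹ-congˡ (≈ᴹ-sym (neg-+ x′ y′)))) (+∈ p q)
        ; +-assoc = λ x y z → ≈⇒~ (+ᴹ-assoc x y z)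
        ; +-comm = λ x y → ≈⇒~ (+ᴹ-comm x y)
        ; +-identityˡ = λ x → ≈⇒~ (+ᴹ-identityˡ x)
        ; -‿cong = λ {x} {y} p → resp (neg-+ x (-ᴹ y)) (-∈ p)
        ; -‿inverseˡ = λ x → ≈⇒~ (-ᴹ‿inverseˡ x)
        ; *-cong = λ {s} {t} {x} {y} s≈t p → ~-trans
            (resp (≈ᴹ-trans (*ₗ-distribˡ s x _) (+ᴹ-congˡ (neg-* s y))) (*∈ s p))
            (≈⇒~ (*ₗ-congʳ s≈t))
        ; *-zeroˡ = λ x → ≈⇒~ (*ₗ-zeroˡ x)
        ; *-zeroʳ = λ s → ≈⇒~ (*ₗ-zeroʳ s)
        ; *-identityˡ = λ x → ≈⇒~ (*ₗ-identityˡ x)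
        ; *-assoc = λ s t x → ≈⇒~ (*ₗ-assoc s t x)
        ; *-distribʳ = λ x s t → ≈⇒~ (*ₗ-distribʳ x s t)
        ; *-distribˡ = λ s x y → ≈⇒~ (*ₗ-distribˡ s x y) }

  module _ (M : Module R m ℓm) (N : Module R m′ ℓm′) where
    private
      module M = Module M
      module N = Module N

    record IsLinear (f : M.Carrierᴹ → N.Carrierᴹ) : Set (r ⊔ m ⊔ ℓm ⊔ ℓm′) where
      field
        f-cong : ∀ {x y} → x M.≈ᴹ y → f x N.≈ᴹ f y
        +-homo : ∀ x y → f (x M.+ᴹ y) N.≈ᴹ f x N.+ᴹ f y
        *-homo : ∀ s x → f (s M.*ₗ x) N.≈ᴹ s N.*ₗ f x

      0-homo : f M.0ᴹ N.≈ᴹ N.0ᴹ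
      0-homo = begin
        f M.0ᴹ              ≈⟨ f-cong (M.*ₗ-zeroˡ M.0ᴹ) ⟨
        f (0# M.*ₗ M.0ᴹ)    ≈⟨ *-homo 0# M.0ᴹ ⟩
        0# N.*ₗ f M.0ᴹ      ≈⟨ N.*ₗ-zeroˡ _ ⟩
        N.0ᴹ                ∎
        where open SetoidReasoning N.≈ᴹ-setoid

      neg-homo : ∀ x → f (M.-ᴹ x) N.≈ᴹ N.-ᴹ f x
      neg-homo x = G.inverseˡ-unique _ (f x) (begin
        f (M.-ᴹ x) N.+ᴹ f x  ≈⟨ +-homo _ x ⟨
        f (M.-ᴹ x M.+ᴹ x)    ≈⟨ f-cong (M.-ᴹ‿inverseˡ x) ⟩
        f M.0ᴹ               ≈⟨ 0-homo ⟩
        N.0ᴹ                 ∎)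
        where
        open SetoidReasoning N.≈ᴹ-setoid
        module G = AbelianGroupProperties N.+ᴹ-abelianGroup

  -- All operads here have no component of arity 0.  component k is the
  -- component of arity suc k, so that the input positions are Fin (suc k),
  -- counted from 0, and arity n + m - 1 becomes index k + l.
  record Operad m ℓm : Set (r ⊔ ℓr ⊔ lsuc (m ⊔ ℓm)) where
    field
      component : ℕ → Module R m ℓm

    module Component {k} = Module (component k)
    open Component public using (_≈ᴹ_; _+ᴹ_; _*ₗ_; -ᴹ_; 0ᴹ)

    ⟦_⟧ : ℕ → Set m
    ⟦ k ⟧ = Module.Carrierᴹ (component k)

    infixl 6 _-ᴹ_
    _-ᴹ_ : ∀ {k} → ⟦ k ⟧ → ⟦ k ⟧ → ⟦ k ⟧
    x -ᴹ y = x +ᴹ -ᴹ y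

    cast : ∀ {k l} → k ≡ l → ⟦ k ⟧ → ⟦ l ⟧
    cast = subst ⟦_⟧

    infixl 8 _∘⟨_⟩_
    field
      one    : ⟦ 0 ⟧
      _∘⟨_⟩_ : ∀ {k l} → ⟦ k ⟧ → Fin (suc k) → ⟦ l ⟧ → ⟦ k + l ⟧
      linearˡ : ∀ {k l} i (y : ⟦ l ⟧) →
                IsLinear (component k) (component (k + l)) (λ x → x ∘⟨ i ⟩ y)
      linearʳ : ∀ {k l} (x : ⟦ k ⟧) i →
                IsLinear (component l) (component (k + l)) (λ y → x ∘⟨ i ⟩ y)
      identityˡ : ∀ {k} (x : ⟦ k ⟧) → one ∘⟨ zero ⟩ x ≈ᴹ x
      identityʳ : ∀ {k} (x : ⟦ k ⟧) i (e : k + 0 ≡ k) → cast e (x ∘⟨ i ⟩ one) ≈ᴹ x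
      sequential : ∀ {k l n} (x : ⟦ k ⟧) (y : ⟦ l ⟧) (z : ⟦ n ⟧)
                   (i : Fin (suc k)) (j : Fin (suc l)) (h : Fin (suc (k + l))) →
                   toℕ h ≡ toℕ i + toℕ j → (e : k + l + n ≡ k + (l + n)) →
                   cast e ((x ∘⟨ i ⟩ y) ∘⟨ h ⟩ z) ≈ᴹ x ∘⟨ i ⟩ (y ∘⟨ j ⟩ z)
      parallel : ∀ {k l n} (x : ⟦ k ⟧) (y : ⟦ l ⟧) (z : ⟦ n ⟧) (i j : Fin (suc k)) →
                 i Fin.< j → (i′ : Fin (suc (k + n))) → toℕ i′ ≡ toℕ i →
                 (j′ : Fin (suc (k + l))) → toℕ j′ ≡ toℕ j + l →
                 (e : k + l + n ≡ k + n + l) →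
                 cast e ((x ∘⟨ i ⟩ y) ∘⟨ j′ ⟩ z) ≈ᴹ (x ∘⟨ j ⟩ z) ∘⟨ i′ ⟩ y

    ∘-cong : ∀ {k l} {x x′ : ⟦ k ⟧} i {y y′ : ⟦ l ⟧} →
             x ≈ᴹ x′ → y ≈ᴹ y′ → x ∘⟨ i ⟩ y ≈ᴹ x′ ∘⟨ i ⟩ y′
    ∘-cong {x′ = x′} i {y} p q = Component.≈ᴹ-trans
      (IsLinear.f-cong (linearˡ i y) p) (IsLinear.f-cong (linearʳ x′ i) q)

  open Operad using (⟦_⟧)

  module _ (O : Operad m ℓm) (P : Operad m′ ℓm′) where
    private
      module O = Operad O
      module P = Operad P

    record Isomorphism : Set (r ⊔ m ⊔ m′ ⊔ ℓm ⊔ ℓm′) where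
      field
        to    : ∀ k → O.⟦ k ⟧ → P.⟦ k ⟧
        isIso : ∀ k → ModuleMorphisms.IsModuleIsomorphism
                        (Module.rawModule (O.component k))
                        (Module.rawModule (P.component k)) (to k)
        one-homo : to 0 O.one P.≈ᴹ P.one
        ∘-homo   : ∀ {k l} (x : O.⟦ k ⟧) i (y : O.⟦ l ⟧) →
                   to (k + l) (x O.∘⟨ i ⟩ y) P.≈ᴹ to k x P.∘⟨ i ⟩ to l y

  module _ (O : Operad m ℓm) (G : ∀ k → ⟦ O ⟧ k → Set g) where
    open Operad O hiding (⟦_⟧)

    data Generated : ∀ k → ⟦ O ⟧ k → Set (r ⊔ m ⊔ ℓm ⊔ g) where
      gen  : ∀ {k x} → G k x → Generated k x
      unit : Generated 0 one
      comp : ∀ {k l x y} i → Generated k x → Generated l y →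
             Generated (k + l) (x ∘⟨ i ⟩ y)
      0∈   : ∀ {k} → Generated k 0ᴹ
      +∈   : ∀ {k x y} → Generated k x → Generated k y → Generated k (x +ᴹ y)
      *∈   : ∀ {k} s {x} → Generated k x → Generated k (s *ₗ x)
      resp : ∀ {k x y} → x ≈ᴹ y → Generated k x → Generated k y

    private
      subcomponent : ℕ → Module R (r ⊔ m ⊔ ℓm ⊔ g) ℓm
      subcomponent k = submodule (component k) {P = Generated k}
        record { resp = resp ; 0∈ = 0∈ ; +∈ = +∈ ; *∈ = *∈ }

      via : ∀ {k l} (e : k ≡ l) {x : Σ (⟦ O ⟧ k) (Generated k)} {y : ⟦ O ⟧ l} →
            cast e (proj₁ x) ≈ᴹ y →
            proj₁ (subst (λ n → Module.Carrierᴹ (subcomponent n)) e x) ≈ᴹ y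
      via refl p = p

    suboperad : Operad (r ⊔ m ⊔ ℓm ⊔ g) ℓm
    suboperad .Operad.component = subcomponent
    suboperad .Operad.one = one , unit
    suboperad .Operad._∘⟨_⟩_ (x , p) i (y , q) = x ∘⟨ i ⟩ y , comp i p q
    suboperad .Operad.linearˡ i (y , _) = let open IsLinear (linearˡ i y) in record
      { f-cong = f-cong ; +-homo = λ _ _ → +-homo _ _ ; *-homo = λ s _ → *-homo s _ }
    suboperad .Operad.linearʳ (x , _) i = let open IsLinear (linearʳ x i) in record
      { f-cong = f-cong ; +-homo = λ _ _ → +-homo _ _ ; *-homo = λ s _ → *-homo s _ }
    suboperad .Operad.identityˡ (x , _) = identityˡ x
    suboperad .Operad.identityʳ (x , _) i e = via e (identityʳ x i e)
    suboperad .Operad.sequential (x , _) (y , _) (z , _) i j h eq e =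
      via e (sequential x y z i j h eq e)
    suboperad .Operad.parallel (x , _) (y , _) (z , _) i j i<j i′ eqi j′ eqj e =
      via e (parallel x y z i j i<j i′ eqi j′ eqj e)

  module _ (O : Operad m ℓm) (G : ∀ k → ⟦ O ⟧ k → Set g) where
    open Operad O hiding (⟦_⟧)

    data Ideal : ∀ k → ⟦ O ⟧ k → Set (r ⊔ m ⊔ ℓm ⊔ g) where
      gen   : ∀ {k x} → G k x → Ideal k x
      compˡ : ∀ {k l x} i (y : ⟦ O ⟧ l) → Ideal k x → Ideal (k + l) (x ∘⟨ i ⟩ y)
      compʳ : ∀ {k l y} (x : ⟦ O ⟧ k) i → Ideal l y → Ideal (k + l) (x ∘⟨ i ⟩ y)
      0∈    : ∀ {k} → Ideal k 0ᴹ
      +∈    : ∀ {k x y} → Ideal k x → Ideal k y → Ideal k (x +ᴹ y)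
      *∈    : ∀ {k} s {x} → Ideal k x → Ideal k (s *ₗ x)
      resp  : ∀ {k x y} → x ≈ᴹ y → Ideal k x → Ideal k y

    private
      isSub : ∀ k → IsSubmodule (component k) (Ideal k)
      isSub k = record { resp = resp ; 0∈ = 0∈ ; +∈ = +∈ ; *∈ = *∈ }

      mod : ∀ {k} {x y : ⟦ O ⟧ k} → x ≈ᴹ y → Ideal k (x -ᴹ y)
      mod {k} = ≈⇒~ (component k) (isSub k)

      quotientComponent : ℕ → Module R m (r ⊔ m ⊔ ℓm ⊔ g)
      quotientComponent k = quotientModule (component k) (isSub k)

      linear-mod : ∀ {k l} (f : ⟦ O ⟧ k → ⟦ O ⟧ l) →
                   IsLinear (component k) (component l) f →
                   (∀ {x} → Ideal k x → Ideal l (f x)) →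
                   IsLinear (quotientComponent k) (quotientComponent l) f
      linear-mod f lin f∈ .IsLinear.f-cong {x} {y} p = resp
        (Component.≈ᴹ-trans (IsLinear.+-homo lin x (-ᴹ y))
          (Component.+ᴹ-congˡ (IsLinear.neg-homo lin y)))
        (f∈ p)
      linear-mod f lin f∈ .IsLinear.+-homo x y = mod (IsLinear.+-homo lin x y)
      linear-mod f lin f∈ .IsLinear.*-homo s x = mod (IsLinear.*-homo lin s x)

      mod-cast : ∀ {k l} (e : k ≡ l) {x : ⟦ O ⟧ k} {y : ⟦ O ⟧ l} → cast e x ≈ᴹ y →
                 Module._≈ᴹ_ (quotientComponent l)
                   (subst (λ n → Module.Carrierᴹ (quotientComponent n)) e x) y
      mod-cast refl = mod

    quotient : Operad m (r ⊔ m ⊔ ℓm ⊔ g)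
    quotient .Operad.component = quotientComponent
    quotient .Operad.one = one
    quotient .Operad._∘⟨_⟩_ = _∘⟨_⟩_
    quotient .Operad.linearˡ i y =
      linear-mod (_∘⟨ i ⟩ y) (linearˡ i y) (compˡ i y)
    quotient .Operad.linearʳ x i =
      linear-mod (x ∘⟨ i ⟩_) (linearʳ x i) (compʳ x i)
    quotient .Operad.identityˡ x = mod (identityˡ x)
    quotient .Operad.identityʳ x i e = mod-cast e (identityʳ x i e)
    quotient .Operad.sequential x y z i j h eq e =
      mod-cast e (sequential x y z i j h eq e)
    quotient .Operad.parallel x y z i j i<j i′ eqi j′ eqj e =
      mod-cast e (parallel x y z i j i<j i′ eqi j′ eqj e)

  -- Formal linear expressions in X; modulo _≋_ (the module axioms), this is the
  -- free module with basis X.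
  infixl 6 _⊕_
  infixr 7 _⊙_

  data Lin (X : Set a) : Set (r ⊔ a) where
    basis : X → Lin X
    𝟘     : Lin X
    _⊕_   : Lin X → Lin X → Lin X
    _⊙_   : K → Lin X → Lin X

  infix 4 _≋_

  data _≋_ {X : Set a} : Lin X → Lin X → Set (r ⊔ ℓr ⊔ a) where
    ≋-refl      : ∀ {u} → u ≋ u
    ≋-sym       : ∀ {u v} → u ≋ v → v ≋ u
    ≋-trans     : ∀ {u v w} → u ≋ v → v ≋ w → u ≋ w
    ⊕-cong      : ∀ {u u′ v v′} → u ≋ u′ → v ≋ v′ → u ⊕ v ≋ u′ ⊕ v′
    ⊕-assoc     : ∀ u v w → (u ⊕ v) ⊕ w ≋ u ⊕ (v ⊕ w)
    ⊕-comm      : ∀ u v → u ⊕ v ≋ v ⊕ u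
    ⊕-identityˡ : ∀ u → 𝟘 ⊕ u ≋ u
    ⊙-cong      : ∀ {s t u v} → s ≈ t → u ≋ v → s ⊙ u ≋ t ⊙ v
    ⊙-zeroˡ     : ∀ u → 0# ⊙ u ≋ 𝟘
    ⊙-zeroʳ     : ∀ s → s ⊙ 𝟘 ≋ 𝟘
    ⊙-identityˡ : ∀ u → 1# ⊙ u ≋ u
    ⊙-assoc     : ∀ s t u → (s * t) ⊙ u ≋ s ⊙ (t ⊙ u)
    ⊙-distribʳ  : ∀ u s t → (s +ᴷ t) ⊙ u ≋ s ⊙ u ⊕ t ⊙ u
    ⊙-distribˡ  : ∀ s u v → s ⊙ (u ⊕ v) ≋ s ⊙ u ⊕ s ⊙ v

  freeModule : Set a → Module R (r ⊔ a) (r ⊔ ℓr ⊔ a)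
  freeModule X .Module.Carrierᴹ = Lin X
  freeModule X .Module._≈ᴹ_ = _≋_
  freeModule X .Module._+ᴹ_ = _⊕_
  freeModule X .Module._*ₗ_ = _⊙_
  freeModule X .Module._*ᵣ_ u s = s ⊙ u
  freeModule X .Module.0ᴹ = 𝟘
  freeModule X .Module.-ᴹ_ u = (CommutativeRing.-_ R 1#) ⊙ u
  freeModule X .Module.isModule = ModuleLaws.isModule record
    { isEquivalence = record { refl = ≋-refl ; sym = ≋-sym ; trans = ≋-trans }
    ; +-cong = ⊕-cong ; +-assoc = ⊕-assoc ; +-comm = ⊕-comm ; +-identityˡ = ⊕-identityˡ
    ; -‿cong = ⊙-cong (CommutativeRing.refl R)
    ; -‿inverseˡ = λ u → ≋-trans (⊕-cong ≋-refl (≋-sym (⊙-identityˡ u)))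
        (≋-trans (≋-sym (⊙-distribʳ u _ 1#))
          (≋-trans (⊙-cong (CommutativeRing.-‿inverseˡ R 1#) ≋-refl) (⊙-zeroˡ u)))
    ; *-cong = ⊙-cong ; *-zeroˡ = ⊙-zeroˡ ; *-zeroʳ = ⊙-zeroʳ
    ; *-identityˡ = ⊙-identityˡ ; *-assoc = ⊙-assoc
    ; *-distribʳ = ⊙-distribʳ ; *-distribˡ = ⊙-distribˡ
    }

  module _ (M : Module R m ℓm) where
    open Module M

    extend : {X : Set a} → (X → Carrierᴹ) → Lin X → Carrierᴹ
    extend f (basis x) = f x
    extend f 𝟘         = 0ᴹ
    extend f (u ⊕ v)   = extend f u +ᴹ extend f v
    extend f (s ⊙ u)   = s *ₗ extend f u

    extend-cong : {X : Set a} (f : X → Carrierᴹ) {u v : Lin X} →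
                  u ≋ v → extend f u ≈ᴹ extend f v
    extend-cong f ≋-refl             = ≈ᴹ-refl
    extend-cong f (≋-sym p)          = ≈ᴹ-sym (extend-cong f p)
    extend-cong f (≋-trans p q)      = ≈ᴹ-trans (extend-cong f p) (extend-cong f q)
    extend-cong f (⊕-cong p q)       = +ᴹ-cong (extend-cong f p) (extend-cong f q)
    extend-cong f (⊕-assoc u v w)    = +ᴹ-assoc _ _ _
    extend-cong f (⊕-comm u v)       = +ᴹ-comm _ _
    extend-cong f (⊕-identityˡ u)    = +ᴹ-identityˡ _
    extend-cong f (⊙-cong s≈t p)     = *ₗ-cong s≈t (extend-cong f p)
    extend-cong f (⊙-zeroˡ u)        = *ₗ-zeroˡ _
    extend-cong f (⊙-zeroʳ s)        = *ₗ-zeroʳ s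
    extend-cong f (⊙-identityˡ u)    = *ₗ-identityˡ _
    extend-cong f (⊙-assoc s t u)    = *ₗ-assoc s t _
    extend-cong f (⊙-distribʳ u s t) = *ₗ-distribʳ _ s t
    extend-cong f (⊙-distribˡ s u v) = *ₗ-distribˡ s _ _

    extend-linear : {X : Set a} (f : X → Carrierᴹ) →
                    IsLinear (freeModule X) M (extend f)
    extend-linear f .IsLinear.f-cong = extend-cong f
    extend-linear f .IsLinear.+-homo u v = ≈ᴹ-refl
    extend-linear f .IsLinear.*-homo s u = ≈ᴹ-refl

    extend-unique : {X : Set a} {f g : Lin X → Carrierᴹ} →
                    IsLinear (freeModule X) M f → IsLinear (freeModule X) M g →
                    (∀ x → f (basis x) ≈ᴹ g (basis x)) → ∀ u → f u ≈ᴹ g u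
    extend-unique {f = f} {g} F G eq = go
      where
      module F = IsLinear F
      module G = IsLinear G
      go : ∀ u → f u ≈ᴹ g u
      go (basis x) = eq x
      go 𝟘         = ≈ᴹ-trans F.0-homo (≈ᴹ-sym G.0-homo)
      go (u ⊕ v)   = ≈ᴹ-trans (F.+-homo u v)
        (≈ᴹ-trans (+ᴹ-cong (go u) (go v)) (≈ᴹ-sym (G.+-homo u v)))
      go (s ⊙ u)   = ≈ᴹ-trans (F.*-homo s u)
        (≈ᴹ-trans (*ₗ-cong (CommutativeRing.refl R) (go u)) (≈ᴹ-sym (G.*-homo s u)))

  id-linear : (M : Module R m ℓm) → IsLinear M M (λ x → x)
  id-linear M .IsLinear.f-cong p = p
  id-linear M .IsLinear.+-homo x y = Module.≈ᴹ-refl M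
  id-linear M .IsLinear.*-homo s x = Module.≈ᴹ-refl M

  ∘-linear : (L : Module R p g) (M : Module R m ℓm) (N : Module R m′ ℓm′) →
             ∀ {f h} → IsLinear M N f → IsLinear L M h → IsLinear L N (λ x → f (h x))
  ∘-linear L M N F H .IsLinear.f-cong p = IsLinear.f-cong F (IsLinear.f-cong H p)
  ∘-linear L M N F H .IsLinear.+-homo x y = Module.≈ᴹ-trans N
    (IsLinear.f-cong F (IsLinear.+-homo H x y)) (IsLinear.+-homo F _ _)
  ∘-linear L M N F H .IsLinear.*-homo s x = Module.≈ᴹ-trans N
    (IsLinear.f-cong F (IsLinear.*-homo H s x)) (IsLinear.*-homo F s _)

  module _ (S : SetOperad) where
    private
      module S = SetOperad S

      X : ℕ → Set
      X k = S.OfArity (suc k)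

      F : ℕ → Module R r (r ⊔ ℓr)
      F k = freeModule (X k)

      position< : ∀ {k} ((x , _) : X k) (i : Fin (suc k)) → toℕ i < S.arity x
      position< (x , p) i = subst (toℕ i <_) (≡.sym p) (Fin.toℕ<n i)

      X-≡ : ∀ {k l} (e : k ≡ l) {x : X k} {y : X l} → proj₁ x ≡ proj₁ y →
            subst (λ n → Lin (X n)) e (basis x) ≋ basis y
      X-≡ refl {x , p} {.x , q} refl with refl ← ℕ.≡-irrelevant p q = ≋-refl

      cast-linear : ∀ {k l} (e : k ≡ l) →
                    IsLinear (F k) (F l) (subst (λ n → Lin (X n)) e)
      cast-linear {k} refl = id-linear (F k)

    compose : ∀ {k l} → X k → Fin (suc k) → X l → X (k + l)
    compose {k} {l} (x , p) i (y , q) =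
      x S.∘[ toℕ i ] y , ℕ.suc-injective (begin
        suc (S.arity (x S.∘[ toℕ i ] y))  ≡⟨ S.arity-∘ x y (position< (x , p) i) ⟩
        S.arity x + S.arity y             ≡⟨ cong₂ _+_ p q ⟩
        suc k + suc l                     ≡⟨ cong suc (ℕ.+-suc k l) ⟩
        suc (suc (k + l))                 ∎)
      where open ≡.≡-Reasoning

    bicompose : ∀ {k l} → Lin (X k) → Fin (suc k) → Lin (X l) → Lin (X (k + l))
    bicompose {k} {l} u i v =
      extend (F (k + l)) (λ x → extend (F (k + l)) (λ y → basis (compose x i y)) v) u

    private
      bicompose-linearˡ : ∀ {k l} i (v : Lin (X l)) →
                          IsLinear (F k) (F (k + l)) (λ u → bicompose u i v)
      bicompose-linearˡ {k} {l} i v = extend-linear (F (k + l)) _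

      bicompose-linearʳ : ∀ {k l} (u : Lin (X k)) i →
                          IsLinear (F l) (F (k + l)) (λ v → bicompose u i v)
      bicompose-linearʳ {k} {l} u i = go u
        where
        go : ∀ u → IsLinear (F l) (F (k + l)) (λ v → bicompose u i v)
        go (basis x) = extend-linear (F (k + l)) _
        go 𝟘 = record { f-cong = λ _ → ≋-refl ; +-homo = λ _ _ → ≋-sym (⊕-identityˡ 𝟘)
                      ; *-homo = λ s _ → ≋-sym (⊙-zeroʳ s) }
        go (u ⊕ u′) = record
          { f-cong = λ p → ⊕-cong (U.f-cong p) (U′.f-cong p)
          ; +-homo = λ v w → ≋-trans (⊕-cong (U.+-homo v w) (U′.+-homo v w))
              (interchange _ _ _ _)
          ; *-homo = λ s v → ≋-trans (⊕-cong (U.*-homo s v) (U′.*-homo s v))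
              (≋-sym (⊙-distribˡ s _ _))
          }
          where
          module U = IsLinear (go u)
          module U′ = IsLinear (go u′)
          open CommutativeSemigroupProperties (CommutativeMonoid.commutativeSemigroup
            (Module.+ᴹ-commutativeMonoid (F (k + l)))) using (interchange)
        go (s ⊙ u) = record
          { f-cong = λ p → ⊙-cong (CommutativeRing.refl R) (U.f-cong p)
          ; +-homo = λ v w → ≋-trans (⊙-cong (CommutativeRing.refl R) (U.+-homo v w))
              (⊙-distribˡ s _ _)
          ; *-homo = λ t v → ≋-trans (⊙-cong (CommutativeRing.refl R) (U.*-homo t v))
              (≋-trans (≋-sym (⊙-assoc s t _))
                (≋-trans (⊙-cong (CommutativeRing.*-comm R s t) ≋-refl) (⊙-assoc t s _)))
          }
          where module U = IsLinear (go u)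

      oneX : X 0
      oneX = S.one , S.arity-one

      bi-identityˡ : ∀ {k} (u : Lin (X k)) → bicompose (basis oneX) zero u ≋ u
      bi-identityˡ {k} = extend-unique (F k) (bicompose-linearʳ (basis oneX) zero)
        (id-linear (F k)) (λ x → X-≡ refl (S.identityˡ (proj₁ x)))

      bi-identityʳ : ∀ {k} (u : Lin (X k)) i (e : k + 0 ≡ k) →
                     subst (λ n → Lin (X n)) e (bicompose u i (basis oneX)) ≋ u
      bi-identityʳ {k} u i e = extend-unique (F k)
        (∘-linear (F k) (F (k + 0)) (F k) (cast-linear e) (bicompose-linearˡ i (basis oneX)))
        (id-linear (F k))
        (λ x → X-≡ e (S.identityʳ (proj₁ x) (position< x i))) u

      bi-sequential : ∀ {k l n} (u : Lin (X k)) (v : Lin (X l)) (w : Lin (X n))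
        (i : Fin (suc k)) (j : Fin (suc l)) (h : Fin (suc (k + l))) →
        toℕ h ≡ toℕ i + toℕ j → (e : k + l + n ≡ k + (l + n)) →
        subst (λ n → Lin (X n)) e (bicompose (bicompose u i v) h w) ≋
        bicompose u i (bicompose v j w)
      bi-sequential {k} {l} {n} u v w i j h eq e = extend-unique N
        (∘-linear (F k) M N C (∘-linear (F k) (F (k + l)) M
          (bicompose-linearˡ h w) (bicompose-linearˡ i v)))
        (bicompose-linearˡ i (bicompose v j w))
        (λ x → extend-unique N
          (∘-linear (F l) M N C (∘-linear (F l) (F (k + l)) M
            (bicompose-linearˡ h w) (bicompose-linearʳ (basis x) i)))
          (∘-linear (F l) (F (l + n)) N
            (bicompose-linearʳ (basis x) i) (bicompose-linearˡ j w))
          (λ y → extend-unique N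
            (∘-linear (F n) M N C (bicompose-linearʳ (basis (compose x i y)) h))
            (∘-linear (F n) (F (l + n)) N
              (bicompose-linearʳ (basis x) i) (bicompose-linearʳ (basis y) j))
            (λ z → X-≡ e (≡.trans
              (cong (λ p → (proj₁ x S.∘[ toℕ i ] proj₁ y) S.∘[ p ] proj₁ z) eq)
              (S.sequential (proj₁ x) (proj₁ y) (proj₁ z) (position< x i) (position< y j))))
            w)
          v)
        u
        where
        M N : Module R r (r ⊔ ℓr)
        M = F (k + l + n)
        N = F (k + (l + n))
        C : IsLinear M N (subst (λ n → Lin (X n)) e)
        C = cast-linear e

      bi-parallel : ∀ {k l n} (u : Lin (X k)) (v : Lin (X l)) (w : Lin (X n))
        (i j : Fin (suc k)) → i Fin.< j → (i′ : Fin (suc (k + n))) → toℕ i′ ≡ toℕ i →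
        (j′ : Fin (suc (k + l))) → toℕ j′ ≡ toℕ j + l → (e : k + l + n ≡ k + n + l) →
        subst (λ n → Lin (X n)) e (bicompose (bicompose u i v) j′ w) ≋
        bicompose (bicompose u j w) i′ v
      bi-parallel {k} {l} {n} u v w i j i<j i′ eqi j′ eqj e = extend-unique N
        (∘-linear (F k) M N C (∘-linear (F k) (F (k + l)) M
          (bicompose-linearˡ j′ w) (bicompose-linearˡ i v)))
        (∘-linear (F k) (F (k + n)) N (bicompose-linearˡ i′ v) (bicompose-linearˡ j w))
        (λ x → extend-unique N
          (∘-linear (F l) M N C (∘-linear (F l) (F (k + l)) M
            (bicompose-linearˡ j′ w) (bicompose-linearʳ (basis x) i)))
          (bicompose-linearʳ (bicompose (basis x) j w) i′)
          (λ y → extend-unique N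
            (∘-linear (F n) M N C (bicompose-linearʳ (basis (compose x i y)) j′))
            (∘-linear (F n) (F (k + n)) N
              (bicompose-linearˡ i′ (basis y)) (bicompose-linearʳ (basis x) j))
            (λ z → X-≡ e (≡.trans
              (S.parallel (proj₁ x) (proj₁ y) (proj₁ z) i<j (position< x j)
                (≡.trans (cong suc eqj) (≡.trans (≡.sym (ℕ.+-suc (toℕ j) l))
                  (cong (toℕ j +_) (≡.sym (proj₂ y))))))
              (cong (λ p → (proj₁ x S.∘[ toℕ j ] proj₁ z) S.∘[ p ] proj₁ y) (≡.sym eqi))))
            w)
          v)
        u
        where
        M N : Module R r (r ⊔ ℓr)
        M = F (k + l + n)
        N = F (k + n + l)
        C : IsLinear M N (subst (λ n → Lin (X n)) e)
        C = cast-linear e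

    linearise : Operad r (r ⊔ ℓr)
    linearise .Operad.component k = F k
    linearise .Operad.one = basis oneX
    linearise .Operad._∘⟨_⟩_ = bicompose
    linearise .Operad.linearˡ = bicompose-linearˡ
    linearise .Operad.linearʳ = bicompose-linearʳ
    linearise .Operad.identityˡ = bi-identityˡ
    linearise .Operad.identityʳ = bi-identityʳ
    linearise .Operad.sequential = bi-sequential
    linearise .Operad.parallel = bi-parallel

  module _ (S : Set) where
    open Trees S

    Free : Operad r (r ⊔ ℓr)
    Free = linearise treeOperad

    corolla : S → ⟦ Free ⟧ 1
    corolla s = basis (node s leaf leaf , refl)

  -- The isomorphism is required to send each generator s to the element value s
  -- of O that it stands for.
  record Presentation (O : Operad m ℓm) (S : Set) (value : S → ⟦ O ⟧ 1)
                      (Rel : ∀ k → ⟦ Free S ⟧ k → Set g)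
                      : Set (r ⊔ ℓr ⊔ m ⊔ ℓm ⊔ g) where
    field
      iso : Isomorphism (quotient (Free S) Rel) O
      iso-corolla : ∀ s → Operad._≈ᴹ_ O (Isomorphism.to iso 1 (corolla S s)) (value s)

-- a : Fin γ stands for the integer toℕ a + 1 of {1, …, γ}; as a letter it is suc a.
data 𝔊 (γ : ℕ) : Set where
  ⊣ ⊢ : Fin γ → 𝔊 γ

module _ (R : CommutativeRing r ℓr) (γ : ℕ) where

  WordOperad : Operad R r (r ⊔ ℓr)
  WordOperad = linearise R (Words.wordOperad γ)

  word : 𝔊 γ → Operad.⟦_⟧ WordOperad 1
  word (⊣ a) = basis (zero ∷ suc a ∷ [] , refl)
  word (⊢ a) = basis (suc a ∷ zero ∷ [] , refl)

  data DiasGenerator : ∀ k → Operad.⟦_⟧ WordOperad k → Set where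
    word∈ : ∀ s → DiasGenerator 1 (word s)

  Dias : Operad R (r ⊔ ℓr) (r ⊔ ℓr)
  Dias = suboperad R WordOperad DiasGenerator

  wordᴰ : 𝔊 γ → Operad.⟦_⟧ Dias 1
  wordᴰ s = word s , gen (word∈ s)

  open Operad (Free R (𝔊 γ))

  -- The second case is a = γ.
  bar : (Fin γ → ⟦ 1 ⟧) → Fin γ → ⟦ 1 ⟧
  bar f a with suc (toℕ a) ℕ.<? γ
  ... | yes a+1<γ = f a -ᴹ f (fromℕ< a+1<γ)
  ... | no  _     = f a

  ⊣̄ ⊢̄ : Fin γ → ⟦ 1 ⟧
  ⊣̄ = bar (λ a → corolla R (𝔊 γ) (⊣ a))
  ⊢̄ = bar (λ a → corolla R (𝔊 γ) (⊢ a))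

  infixl 7 _∘₁_ _∘₂_
  _∘₁_ _∘₂_ : ⟦ 1 ⟧ → ⟦ 1 ⟧ → ⟦ 2 ⟧
  x ∘₁ y = x ∘⟨ zero ⟩ y
  x ∘₂ y = x ∘⟨ suc zero ⟩ y

  ∑≥ : Fin γ → (Fin γ → ⟦ 2 ⟧) → ⟦ 2 ⟧
  ∑≥ a f = foldr _+ᴹ_ 0ᴹ (map f (filter (a Fin.≤?_) (allFin γ)))

  -- The barred generators form a basis of the component of arity 2, so relations
  -- between them are relations in the free operad on 𝔊 γ.
  data Relation : ∀ k → ⟦ k ⟧ → Set where
    ⊣∘₁⊢    : ∀ a a′ → Relation 2 (⊣̄ a ∘₁ ⊢̄ a′ -ᴹ ⊢̄ a′ ∘₂ ⊣̄ a)

    ⊢b∘₁⊢a  : ∀ {a b} → a Fin.< b → Relation 2 (⊢̄ b ∘₁ ⊢̄ a)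
    ⊣b∘₂⊣a  : ∀ {a b} → a Fin.< b → Relation 2 (⊣̄ b ∘₂ ⊣̄ a)
    ⊢b∘₁⊣a  : ∀ {a b} → a Fin.< b → Relation 2 (⊢̄ b ∘₁ ⊣̄ a)
    ⊣b∘₂⊢a  : ∀ {a b} → a Fin.< b → Relation 2 (⊣̄ b ∘₂ ⊢̄ a)
    ⊢a∘₁⊢b  : ∀ {a b} → a Fin.< b → Relation 2 (⊢̄ a ∘₁ ⊢̄ b -ᴹ ⊢̄ b ∘₂ ⊢̄ a)
    ⊣b∘₁⊣a  : ∀ {a b} → a Fin.< b → Relation 2 (⊣̄ b ∘₁ ⊣̄ a -ᴹ ⊣̄ a ∘₂ ⊣̄ b)
    ⊢a∘₁⊣b  : ∀ {a b} → a Fin.< b → Relation 2 (⊢̄ a ∘₁ ⊣̄ b -ᴹ ⊢̄ a ∘₂ ⊢̄ b)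
    ⊣a∘₁⊣b  : ∀ {a b} → a Fin.< b → Relation 2 (⊣̄ a ∘₁ ⊣̄ b -ᴹ ⊣̄ a ∘₂ ⊢̄ b)

    ⊢a∘₁⊢a  : ∀ a → Relation 2 (⊢̄ a ∘₁ ⊢̄ a -ᴹ ∑≥ a (λ b → ⊢̄ a ∘₂ ⊢̄ b))
    ⊣a∘₂⊣a  : ∀ a → Relation 2 (∑≥ a (λ b → ⊣̄ a ∘₁ ⊣̄ b) -ᴹ ⊣̄ a ∘₂ ⊣̄ a)
    ⊢a∘₁⊣a  : ∀ a → Relation 2 (⊢̄ a ∘₁ ⊣̄ a -ᴹ ∑≥ a (λ b → ⊢̄ b ∘₂ ⊢̄ a))
    ⊣a∘₂⊢a  : ∀ a → Relation 2 (∑≥ a (λ b → ⊣̄ b ∘₁ ⊣̄ a) -ᴹ ⊣̄ a ∘₂ ⊢̄ a)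

{-# OPTIONS --safe #-}
-- The barred generators are differences of consecutive plain ones, so a plain generator
-- of index a is the sum of the barred ones of index b ≥ a.  Extending the plain generators
-- by 0 beyond γ, each family of barred relations is the mixed difference of a family of
-- plain relations, such as ⊢ a ∘₁ ⊢ b = ⊢ (max a b) ∘₂ ⊢ a, which hold between words;
-- mixed differences determine a grid vanishing beyond γ, so both families span the same
-- space.  The plain relations, oriented as rewriting rules, turn every tree t into the
-- normal tree that is read off the word of t.  Hence u ↦ normal tree of the word is
-- inverse, modulo the relations, to the evaluation of trees as words.
module Submission where

open import Defs
open import Algebra.Apartness.Bundles using (HeytingField)
open import Data.Nat.Base using (ℕ)
open import Level using (_⊔_)
open import Algebra.Bundles using (CommutativeRing; CommutativeMonoid)
import Algebra.Construct.NaturalChoice.Max as Max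
open import Algebra.Module.Bundles using (Module)
import Algebra.Properties.AbelianGroup as AbelianGroupProperties
import Algebra.Properties.CommutativeSemigroup as CommutativeSemigroupProperties
open import Data.Fin.Base as Fin using (Fin; zero; suc; toℕ; fromℕ<)
import Data.Fin.Properties as Fin
open import Data.List.Base
  using (List; []; _∷_; _++_; map; foldr; foldl; filter; length; tabulate)
open import Data.List.Properties
  using (++-assoc; ++-identityʳ; map-++; map-cong; map-∘; map-id; foldr-++; foldl-++;
         filter-accept; filter-reject)
open import Data.Nat.Base as ℕ using (zero; suc; _+_; _∸_; _<_; _≤_; z≤n; s≤s)
import Data.Nat.Properties as ℕ
open import Data.Product.Base using (Σ; ∃; _×_; _,_; proj₁; proj₂)
open import Data.Sum.Base using (_⊎_; inj₁; inj₂; swap)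
open import Function.Base using (_∘_; id)
open import Relation.Binary.Definitions using (tri<; tri≈; tri>)
open import Relation.Binary.PropositionalEquality
  using (_≡_; refl; sym; trans; cong; cong₂; subst; subst₂; module ≡-Reasoning)
import Relation.Binary.Reasoning.Setoid as SetoidReasoning
open import Relation.Nullary using (yes; no; contradiction)

-- Evaluation of binary trees in a set operad

module Evaluation (O : SetOperad) {S : Set} (value : S → SetOperad.El O)
                  (binary : ∀ s → SetOperad.arity O (value s) ≡ 2) where
  open SetOperad O
  open Trees S

  -- The right subtree is inserted first, so that position 0 of the left one is not shifted.
  eval : Tree → El
  eval leaf         = one
  eval (node s t u) = (value s ∘[ 1 ] eval u) ∘[ 0 ] eval t

  leaves>0 : ∀ t → 0 < leaves t
  leaves>0 leaf         = s≤s z≤n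
  leaves>0 (node s t u) = ℕ.≤-trans (leaves>0 t) (ℕ.m≤m+n _ _)

  private
    below : ∀ s {i} → i < 2 → i < arity (value s)
    below s = subst (_ <_) (sym (binary s))

    arity-right : ∀ s x → arity (value s ∘[ 1 ] x) ≡ suc (arity x)
    arity-right s x = ℕ.suc-injective
      (trans (arity-∘ (value s) x (below s ℕ.≤-refl)) (cong (_+ arity x) (binary s)))

    0<right : ∀ s x → 0 < arity (value s ∘[ 1 ] x)
    0<right s x = subst (0 <_) (sym (arity-right s x)) (s≤s z≤n)

  arity-eval : ∀ t → arity (eval t) ≡ leaves t
  arity-eval leaf         = arity-one
  arity-eval (node s t u) = ℕ.suc-injective (begin
    suc (arity ((value s ∘[ 1 ] eval u) ∘[ 0 ] eval t))
      ≡⟨ arity-∘ _ (eval t) (0<right s (eval u)) ⟩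
    arity (value s ∘[ 1 ] eval u) + arity (eval t)
      ≡⟨ cong₂ _+_ (trans (arity-right s (eval u)) (cong suc (arity-eval u))) (arity-eval t) ⟩
    suc (leaves u + leaves t)
      ≡⟨ cong suc (ℕ.+-comm (leaves u) _) ⟩
    suc (leaves t + leaves u) ∎)
    where open ≡-Reasoning

  -- A graft into the left subtree is `sequential` alone; one into the right subtree is `sequential`
  -- at position 1, then `parallel` to move past the left subtree.
  eval-graft : ∀ t {i} v → i < leaves t → eval (graft t i v) ≡ eval t ∘[ i ] eval v
  eval-graft leaf {zero} v _ = sym (identityˡ (eval v))
  eval-graft leaf {suc i} v (s≤s ())
  eval-graft (node s t u) {i} v i< with i ℕ.<? leaves t
  ... | yes p = begin
    x ∘[ 0 ] eval (graft t i v)      ≡⟨ cong (x ∘[ 0 ]_) (eval-graft t v p) ⟩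
    x ∘[ 0 ] (eval t ∘[ i ] eval v)  ≡⟨ sequential x (eval t) (eval v) (0<right s (eval u))
                                          (subst (i <_) (sym (arity-eval t)) p) ⟨
    (x ∘[ 0 ] eval t) ∘[ i ] eval v  ∎
    where
    open ≡-Reasoning
    x = value s ∘[ 1 ] eval u
  ... | no ¬p = begin
    (value s ∘[ 1 ] eval (graft u k v)) ∘[ 0 ] eval t
      ≡⟨ cong (λ y → (value s ∘[ 1 ] y) ∘[ 0 ] eval t) (eval-graft u v k<) ⟩
    (value s ∘[ 1 ] (eval u ∘[ k ] eval v)) ∘[ 0 ] eval t
      ≡⟨ cong (_∘[ 0 ] eval t) (sequential (value s) (eval u) (eval v) (below s ℕ.≤-refl) k<′) ⟨
    ((value s ∘[ 1 ] eval u) ∘[ suc k ] eval v) ∘[ 0 ] eval t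
      ≡⟨ parallel (value s ∘[ 1 ] eval u) (eval t) (eval v) (s≤s z≤n)
           (subst (suc k <_) (sym (arity-right s (eval u))) (s≤s k<′)) 1+i≡ ⟨
    ((value s ∘[ 1 ] eval u) ∘[ 0 ] eval t) ∘[ i ] eval v ∎
    where
    open ≡-Reasoning
    k = i ∸ leaves t
    i≡ : leaves t + k ≡ i
    i≡ = ℕ.m+[n∸m]≡n (ℕ.≮⇒≥ ¬p)
    k< : k < leaves u
    k< = ℕ.+-cancelˡ-< (leaves t) _ _ (subst (_< leaves t + leaves u) (sym i≡) i<)
    k<′ : k < arity (eval u)
    k<′ = subst (k <_) (sym (arity-eval u)) k<
    -- Filling input 0 with `eval t` replaces one input by `leaves t` of them, which moves position
    -- `suc k` to `i`.
    1+i≡ : suc i ≡ suc k + arity (eval t)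
    1+i≡ = cong suc (begin
      i                    ≡⟨ i≡ ⟨
      leaves t + k         ≡⟨ ℕ.+-comm (leaves t) k ⟩
      k + leaves t         ≡⟨ cong (k +_) (arity-eval t) ⟨
      k + arity (eval t)   ∎)

-- Rewriting of trees to normal form

module Rewriting (γ : ℕ) where
  open Words γ using (Letter; wordOperad)
  open Trees (𝔊 γ)
  private
    module Maxᴸ = Max (Fin.≤-totalOrder (suc γ))
    module Maxᶠ = Max (Fin.≤-totalOrder γ)

  infixl 6 _∨_
  _∨_ : Fin γ → Fin γ → Fin γ
  _∨_ = Maxᶠ._⊔_

  toℕ-∨ : ∀ a b → toℕ (a ∨ b) ≡ toℕ a ℕ.⊔ toℕ b
  toℕ-∨ a b with Fin.≤-total a b
  ... | inj₁ a≤b = trans (cong toℕ (Maxᶠ.x≤y⇒x⊔y≈y a≤b)) (sym (ℕ.m≤n⇒m⊔n≡n a≤b))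
  ... | inj₂ b≤a = trans (cong toℕ (Maxᶠ.x≤y⇒y⊔x≈y b≤a)) (sym (ℕ.m≥n⇒m⊔n≡m b≤a))

  suc-∨ : ∀ a b → suc a Maxᴸ.⊔ suc b ≡ suc (a ∨ b)
  suc-∨ a b with Fin.≤-total a b
  ... | inj₁ a≤b = trans (Maxᴸ.x≤y⇒x⊔y≈y (s≤s a≤b)) (cong suc (sym (Maxᶠ.x≤y⇒x⊔y≈y a≤b)))
  ... | inj₂ b≤a = trans (Maxᴸ.x≤y⇒y⊔x≈y (s≤s b≤a)) (cong suc (sym (Maxᶠ.x≤y⇒y⊔x≈y b≤a)))

  infix 4 _⇒_
  -- Each rule keeps the word of the tree. No rule applies exactly when every `⊢` node has a leaf on
  -- its left and every `⊣` node has a leaf on its right and no `⊢` node on its left: these are the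
  -- trees `normal`.
  data _⇒_ : Tree → Tree → Set where
    ⇒-refl    : ∀ {t} → t ⇒ t
    ⇒-trans   : ∀ {t u v} → t ⇒ u → u ⇒ v → t ⇒ v
    node-cong : ∀ s {t t′ u u′} → t ⇒ t′ → u ⇒ u′ → node s t u ⇒ node s t′ u′
    ⊣∘₁⊢ : ∀ a b t u v → node (⊣ a) (node (⊢ b) t u) v ⇒ node (⊢ b) t (node (⊣ a) u v)
    ⊢∘₁⊢ : ∀ a b t u v → node (⊢ a) (node (⊢ b) t u) v ⇒ node (⊢ (a ∨ b)) t (node (⊢ a) u v)
    ⊢∘₁⊣ : ∀ a b t u v → node (⊢ a) (node (⊣ b) t u) v ⇒ node (⊢ a) t (node (⊢ (a ∨ b)) u v)
    ⊣∘₂⊣ : ∀ a b t u v → node (⊣ a) t (node (⊣ b) u v) ⇒ node (⊣ (a ∨ b)) (node (⊣ a) t u) v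
    ⊣∘₂⊢ : ∀ a b t u v → node (⊣ a) t (node (⊢ b) u v) ⇒ node (⊣ a) (node (⊣ (a ∨ b)) t u) v

  leaves-⇒ : ∀ {t u} → t ⇒ u → leaves t ≡ leaves u
  leaves-⇒ ⇒-refl             = refl
  leaves-⇒ (⇒-trans p q)      = trans (leaves-⇒ p) (leaves-⇒ q)
  leaves-⇒ (node-cong _ p q)  = cong₂ _+_ (leaves-⇒ p) (leaves-⇒ q)
  leaves-⇒ (⊣∘₁⊢ _ _ t _ _) = ℕ.+-assoc (leaves t) _ _
  leaves-⇒ (⊢∘₁⊢ _ _ t _ _) = ℕ.+-assoc (leaves t) _ _
  leaves-⇒ (⊢∘₁⊣ _ _ t _ _) = ℕ.+-assoc (leaves t) _ _
  leaves-⇒ (⊣∘₂⊣ _ _ t _ _) = sym (ℕ.+-assoc (leaves t) _ _)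
  leaves-⇒ (⊣∘₂⊢ _ _ t _ _) = sym (ℕ.+-assoc (leaves t) _ _)

  -- The pair (l , r) encodes the word l 0 r with a single 0; these words span Dias.
  Pointed : Set
  Pointed = List (Fin γ) × List (Fin γ)

  -- The operand whose letters are raised by `a` has its 0 turned into `a`; the 0 of the other
  -- operand remains.
  pointed : Tree → Pointed
  pointed leaf = [] , []
  pointed (node (⊣ a) t u) = let (l , r) = pointed t ; (l′ , r′) = pointed u in
    l , r ++ map (a ∨_) l′ ++ a ∷ map (a ∨_) r′
  pointed (node (⊢ a) t u) = let (l , r) = pointed t ; (l′ , r′) = pointed u in
    map (a ∨_) l ++ a ∷ map (a ∨_) r ++ l′ , r′

  ⊢-spine : List (Fin γ) → Tree → Tree
  ⊢-spine l t = foldr (λ a → node (⊢ a) leaf) t l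

  ⊣-spine : Tree → List (Fin γ) → Tree
  ⊣-spine = foldl (λ t a → node (⊣ a) t leaf)

  normal : Pointed → Tree
  normal (l , r) = ⊢-spine l (⊣-spine leaf r)

  ⊢-spine-cong : ∀ l {t u} → t ⇒ u → ⊢-spine l t ⇒ ⊢-spine l u
  ⊢-spine-cong []      p = p
  ⊢-spine-cong (a ∷ l) p = node-cong (⊢ a) ⇒-refl (⊢-spine-cong l p)

  ⊣-spine-cong : ∀ {t u} r → t ⇒ u → ⊣-spine t r ⇒ ⊣-spine u r
  ⊣-spine-cong []      p = p
  ⊣-spine-cong (a ∷ r) p = ⊣-spine-cong r (node-cong (⊣ a) p ⇒-refl)

  -- The root of the spine carries the last letter of `r`. Each `⊢∘₁⊣` detaches one leaf with its
  -- letter, raised by `a`, so the letters stack up on `u` from last to first.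
  ⊢-⊣-spine : ∀ a t r u → node (⊢ a) (⊣-spine t r) u ⇒ node (⊢ a) t (⊢-spine (map (a ∨_) r) u)
  ⊢-⊣-spine a t []      u = ⇒-refl
  ⊢-⊣-spine a t (b ∷ r) u =
    ⇒-trans (⊢-⊣-spine a (node (⊣ b) t leaf) r u) (⊢∘₁⊣ a b t leaf _)

  -- `⊢∘₁⊢` passes `a` down along `l`, raising each letter; the leaf standing for 0 takes the letter
  -- `a`; then `⊢-⊣-spine` treats `r`.
  ⊢-normal : ∀ a l r u →
    node (⊢ a) (normal (l , r)) u ⇒ ⊢-spine (map (a ∨_) l ++ a ∷ map (a ∨_) r) u
  ⊢-normal a []      r u = ⊢-⊣-spine a leaf r u
  ⊢-normal a (b ∷ l) r u =
    ⇒-trans (⊢∘₁⊢ a b leaf _ u) (node-cong (⊢ (a ∨ b)) ⇒-refl (⊢-normal a l r u))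

  ⊣-⊣-spine : ∀ a t u r → node (⊣ a) t (⊣-spine u r) ⇒ ⊣-spine (node (⊣ a) t u) (map (a ∨_) r)
  ⊣-⊣-spine a t u []      = ⇒-refl
  ⊣-⊣-spine a t u (b ∷ r) = ⇒-trans (⊣-⊣-spine a t (node (⊣ b) u leaf) r)
    (⊣-spine-cong (map (a ∨_) r) (⊣∘₂⊣ a b t u leaf))

  -- `⊣∘₂⊢` moves the letters of `l`, raised by `a`, onto the left operand `t`, which accumulates
  -- them; `⊣-⊣-spine` then appends `a` and the letters of `r`.
  ⊣-normal : ∀ a t l r →
    node (⊣ a) t (normal (l , r)) ⇒ ⊣-spine t (map (a ∨_) l ++ a ∷ map (a ∨_) r)
  ⊣-normal a t []      r = ⊣-⊣-spine a t leaf r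
  ⊣-normal a t (b ∷ l) r =
    ⇒-trans (⊣∘₂⊢ a b t leaf _) (⊣-normal a (node (⊣ (a ∨ b)) t leaf) l r)

  ⊣-⊢-spine : ∀ a l t u → node (⊣ a) (⊢-spine l t) u ⇒ ⊢-spine l (node (⊣ a) t u)
  ⊣-⊢-spine a []      t u = ⇒-refl
  ⊣-⊢-spine a (b ∷ l) t u =
    ⇒-trans (⊣∘₁⊢ a b leaf _ u) (node-cong (⊢ b) ⇒-refl (⊣-⊢-spine a l t u))

  -- Subtrees are normalised first. Under `⊣ a` the `⊢` letters of the left subtree rise above the
  -- root before the right subtree is absorbed into what is left; under `⊢ a` the left subtree is
  -- absorbed into the right one.
  normalise : ∀ t → t ⇒ normal (pointed t)
  normalise leaf = ⇒-refl
  normalise (node (⊣ a) t u) with pointed t | normalise t | pointed u | normalise u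
  ... | l , r | p | l′ , r′ | q =
    ⇒-trans (node-cong (⊣ a) p q)
      (⇒-trans (⊣-⊢-spine a l _ _)
        (⊢-spine-cong l (subst (node (⊣ a) (⊣-spine leaf r) (normal (l′ , r′)) ⇒_)
          (sym (foldl-++ _ leaf r (map (a ∨_) l′ ++ a ∷ map (a ∨_) r′)))
          (⊣-normal a _ l′ r′))))
  normalise (node (⊢ a) t u) with pointed t | normalise t | pointed u | normalise u
  ... | l , r | p | l′ , r′ | q =
    ⇒-trans (node-cong (⊢ a) p q)
      (subst (node (⊢ a) (normal (l , r)) (normal (l′ , r′)) ⇒_)
        (trans (sym (foldr-++ _ _ (map (a ∨_) l ++ a ∷ map (a ∨_) r) l′))
          (cong (λ w → ⊢-spine w (⊣-spine leaf r′)) (++-assoc (map (a ∨_) l) _ l′)))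
        (⊢-normal a l r _))

  -- Words of trees

  ⟦_⟧ᵍ : 𝔊 γ → List Letter
  ⟦ ⊣ a ⟧ᵍ = zero ∷ suc a ∷ []
  ⟦ ⊢ a ⟧ᵍ = suc a ∷ zero ∷ []

  ⟦⟧ᵍ-binary : ∀ s → length ⟦ s ⟧ᵍ ≡ 2
  ⟦⟧ᵍ-binary (⊣ a) = refl
  ⟦⟧ᵍ-binary (⊢ a) = refl

  open Evaluation wordOperad ⟦_⟧ᵍ ⟦⟧ᵍ-binary public

  encode : Pointed → List Letter
  encode (l , r) = map suc l ++ zero ∷ map suc r

  private
    zero-max : ∀ (w : List Letter) → map (zero Maxᴸ.⊔_) w ≡ w
    zero-max w = trans (map-cong (λ x → Maxᴸ.x≤y⇒x⊔y≈y {x} {zero} z≤n) w) (map-id w)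

    max-map-suc : ∀ a l → map (suc a Maxᴸ.⊔_) (map suc l) ≡ map suc (map (a ∨_) l)
    max-map-suc a l = trans (sym (map-∘ l)) (trans (map-cong (suc-∨ a) l) (map-∘ l))

    max-encode : ∀ a l r → map (suc a Maxᴸ.⊔_) (encode (l , r)) ≡
                 map suc (map (a ∨_) l ++ a ∷ map (a ∨_) r)
    max-encode a l r = begin
      map (suc a Maxᴸ.⊔_) (map suc l ++ zero ∷ map suc r)
        ≡⟨ map-++ _ (map suc l) _ ⟩
      map (suc a Maxᴸ.⊔_) (map suc l) ++ (suc a Maxᴸ.⊔ zero) ∷ map (suc a Maxᴸ.⊔_) (map suc r)
        ≡⟨ cong₂ _++_ (max-map-suc a l)
             (cong₂ _∷_ (Maxᴸ.x≤y⇒y⊔x≈y {suc a} {zero} z≤n) (max-map-suc a r)) ⟩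
      map suc (map (a ∨_) l) ++ map suc (a ∷ map (a ∨_) r)
        ≡⟨ map-++ suc (map (a ∨_) l) _ ⟨
      map suc (map (a ∨_) l ++ a ∷ map (a ∨_) r) ∎
      where open ≡-Reasoning

  -- Maximum with `zero` fixes a word; maximum with `suc a` turns its 0 into `suc a` and acts on the
  -- other letters as `a ∨_`.
  eval-pointed : ∀ t → eval t ≡ encode (pointed t)
  eval-pointed leaf = refl
  eval-pointed (node (⊣ a) t u) with pointed t | eval-pointed t | pointed u | eval-pointed u
  ... | l , r | p | l′ , r′ | q = begin
    map (zero Maxᴸ.⊔_) (eval t) ++ map (suc a Maxᴸ.⊔_) (eval u) ++ []
      ≡⟨ cong₂ _++_ (trans (zero-max (eval t)) p)
           (trans (++-identityʳ _) (trans (cong (map (suc a Maxᴸ.⊔_)) q) (max-encode a l′ r′))) ⟩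
    (map suc l ++ zero ∷ map suc r) ++ map suc (map (a ∨_) l′ ++ a ∷ map (a ∨_) r′)
      ≡⟨ ++-assoc (map suc l) _ _ ⟩
    map suc l ++ zero ∷ map suc r ++ map suc (map (a ∨_) l′ ++ a ∷ map (a ∨_) r′)
      ≡⟨ cong (λ w → map suc l ++ zero ∷ w) (map-++ suc r _) ⟨
    map suc l ++ zero ∷ map suc (r ++ map (a ∨_) l′ ++ a ∷ map (a ∨_) r′) ∎
    where open ≡-Reasoning
  eval-pointed (node (⊢ a) t u) with pointed t | eval-pointed t | pointed u | eval-pointed u
  ... | l , r | p | l′ , r′ | q = begin
    map (suc a Maxᴸ.⊔_) (eval t) ++ map (zero Maxᴸ.⊔_) (eval u) ++ []
      ≡⟨ cong₂ _++_ (trans (cong (map (suc a Maxᴸ.⊔_)) p) (max-encode a l r))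
           (trans (++-identityʳ _) (trans (zero-max (eval u)) q)) ⟩
    map suc (map (a ∨_) l ++ a ∷ map (a ∨_) r) ++ map suc l′ ++ zero ∷ map suc r′
      ≡⟨ ++-assoc (map suc (map (a ∨_) l ++ a ∷ map (a ∨_) r)) _ _ ⟨
    (map suc (map (a ∨_) l ++ a ∷ map (a ∨_) r) ++ map suc l′) ++ zero ∷ map suc r′
      ≡⟨ cong (_++ zero ∷ map suc r′) (map-++ suc (map (a ∨_) l ++ a ∷ map (a ∨_) r) l′) ⟨
    map suc ((map (a ∨_) l ++ a ∷ map (a ∨_) r) ++ l′) ++ zero ∷ map suc r′
      ≡⟨ cong (λ w → map suc w ++ zero ∷ map suc r′) (++-assoc (map (a ∨_) l) _ l′) ⟩
    map suc (map (a ∨_) l ++ a ∷ map (a ∨_) r ++ l′) ++ zero ∷ map suc r′ ∎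
    where open ≡-Reasoning

  private
    nonzero : List Letter → List (Fin γ)
    nonzero []          = []
    nonzero (zero ∷ w)  = nonzero w
    nonzero (suc a ∷ w) = a ∷ nonzero w

    nonzero-map-suc : ∀ l → nonzero (map suc l) ≡ l
    nonzero-map-suc []      = refl
    nonzero-map-suc (a ∷ l) = cong (a ∷_) (nonzero-map-suc l)

  -- Meaningful for words with exactly one 0, where it inverts `encode`; other values are defaults.
  decode : List Letter → Pointed
  decode []          = [] , []
  decode (zero ∷ w)  = [] , nonzero w
  decode (suc a ∷ w) = let (l , r) = decode w in a ∷ l , r

  decode-encode : ∀ x → decode (encode x) ≡ x
  decode-encode ([]    , r) = cong ([] ,_) (nonzero-map-suc r)
  decode-encode (a ∷ l , r) = cong (λ (l , r) → a ∷ l , r) (decode-encode (l , r))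

-- Mixed differences of grids

module Differences {r ℓr m ℓm} {R : CommutativeRing r ℓr} (N : Module R m ℓm) (γ : ℕ) where
  open Module N
  open SetoidReasoning ≈ᴹ-setoid
  private
    module G = AbelianGroupProperties +ᴹ-abelianGroup
    open CommutativeSemigroupProperties
      (CommutativeMonoid.commutativeSemigroup +ᴹ-commutativeMonoid) using (interchange)

  infixl 6 _-_
  _-_ : Carrierᴹ → Carrierᴹ → Carrierᴹ
  x - y = x +ᴹ -ᴹ y

  -‿cong₂ : ∀ {x x′ y y′} → x ≈ᴹ x′ → y ≈ᴹ y′ → x - y ≈ᴹ x′ - y′
  -‿cong₂ p q = +ᴹ-cong p (-ᴹ‿cong q)

  x-0≈x : ∀ x → x - 0ᴹ ≈ᴹ x
  x-0≈x x = ≈ᴹ-trans (+ᴹ-congˡ G.ε⁻¹≈ε) (+ᴹ-identityʳ x)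

  x-x-[y-y]≈0 : ∀ x y → (x - x) - (y - y) ≈ᴹ 0ᴹ
  x-x-[y-y]≈0 x y = ≈ᴹ-trans (-‿cong₂ (-ᴹ‿inverseʳ x) (-ᴹ‿inverseʳ y)) (-ᴹ‿inverseʳ 0ᴹ)

  telescope : ∀ x y z → (x - y) +ᴹ (y - z) ≈ᴹ x - z
  telescope x y z = begin
    (x - y) +ᴹ (y - z)          ≈⟨ +ᴹ-assoc x _ _ ⟩
    x +ᴹ (-ᴹ y +ᴹ (y - z))      ≈⟨ +ᴹ-congˡ (+ᴹ-assoc _ y _) ⟨
    x +ᴹ ((-ᴹ y +ᴹ y) +ᴹ -ᴹ z)  ≈⟨ +ᴹ-congˡ (+ᴹ-congʳ (-ᴹ‿inverseˡ y)) ⟩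
    x +ᴹ (0ᴹ +ᴹ -ᴹ z)           ≈⟨ +ᴹ-congˡ (+ᴹ-identityˡ _) ⟩
    x - z                       ∎

  -‿interchange : ∀ w x y z → (w - x) - (y - z) ≈ᴹ (w - y) - (x - z)
  -‿interchange w x y z = begin
    (w - x) - (y - z)              ≈⟨ +ᴹ-congˡ (G.⁻¹-∙-comm y _) ⟨
    (w - x) +ᴹ (-ᴹ y - (-ᴹ z))     ≈⟨ interchange w _ _ _ ⟩
    (w - y) +ᴹ (-ᴹ x - (-ᴹ z))     ≈⟨ +ᴹ-congˡ (G.⁻¹-∙-comm x _) ⟩
    (w - y) - (x - z)              ∎

  x-y≈0⇒x≈y : ∀ {x y} → x - y ≈ᴹ 0ᴹ → x ≈ᴹ y
  x-y≈0⇒x≈y {x} {y} p = G.∙-cancelʳ (-ᴹ y) x y (≈ᴹ-trans p (≈ᴹ-sym (-ᴹ‿inverseʳ y)))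

  x≈y⇒x-y≈0 : ∀ {x y} → x ≈ᴹ y → x - y ≈ᴹ 0ᴹ
  x≈y⇒x-y≈0 {x} {y} p = ≈ᴹ-trans (+ᴹ-congʳ p) (-ᴹ‿inverseʳ y)

  -- Indexing by all naturals makes the successor indices in `Δ` always available.
  Grid : Set m
  Grid = ℕ → ℕ → Carrierᴹ

  Vanishing : Grid → Set ℓm
  Vanishing P = ∀ {i j} → γ ≤ i ⊎ γ ≤ j → P i j ≈ᴹ 0ᴹ

  -- Barring both arguments of a bilinear product turns its grid of values into this
  -- mixed difference.
  Δ : Grid → Grid
  Δ P i j = (P i j - P i (suc j)) - (P (suc i) j - P (suc i) (suc j))

  Δ-cong : ∀ {P Q} → (∀ i j → P i j ≈ᴹ Q i j) → ∀ i j → Δ P i j ≈ᴹ Δ Q i j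
  Δ-cong p i j = -‿cong₂ (-‿cong₂ (p i j) (p i (suc j)))
    (-‿cong₂ (p (suc i) j) (p (suc i) (suc j)))

  grid-ext : ∀ {P Q} → Vanishing P → Vanishing Q →
             (∀ (a b : Fin γ) → P (toℕ a) (toℕ b) ≈ᴹ Q (toℕ a) (toℕ b)) →
             ∀ i j → P i j ≈ᴹ Q i j
  grid-ext {P} {Q} P≈0 Q≈0 P≈Q i j with i ℕ.<? γ | j ℕ.<? γ
  ... | yes i<γ | yes j<γ = subst₂ (λ i j → P i j ≈ᴹ Q i j)
    (Fin.toℕ-fromℕ< i<γ) (Fin.toℕ-fromℕ< j<γ) (P≈Q (fromℕ< i<γ) (fromℕ< j<γ))
  ... | no i≮γ  | _       = ≈ᴹ-trans (P≈0 (inj₁ (ℕ.≮⇒≥ i≮γ))) (≈ᴹ-sym (Q≈0 (inj₁ (ℕ.≮⇒≥ i≮γ))))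
  ... | yes _   | no j≮γ  = ≈ᴹ-trans (P≈0 (inj₂ (ℕ.≮⇒≥ j≮γ))) (≈ᴹ-sym (Q≈0 (inj₂ (ℕ.≮⇒≥ j≮γ))))

  -- Descending induction from the region where both grids vanish: `Δ P i j` involves `P i j` and
  -- three corners with a larger index, so equal differences and equal corners force equal values.
  Δ-injective : ∀ {P Q} → Vanishing P → Vanishing Q →
                (∀ (a b : Fin γ) → Δ P (toℕ a) (toℕ b) ≈ᴹ Δ Q (toℕ a) (toℕ b)) →
                ∀ i j → P i j ≈ᴹ Q i j
  Δ-injective {P} {Q} P≈0 Q≈0 ΔP≈ΔQ i j = go γ γ i j (ℕ.m≤m+n γ i) (ℕ.m≤m+n γ j)
    where
    outside : ∀ {i j} → γ ≤ i ⊎ γ ≤ j → P i j ≈ᴹ Q i j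
    outside p = ≈ᴹ-trans (P≈0 p) (≈ᴹ-sym (Q≈0 p))

    inside : ∀ {i j} → i < γ → j < γ → Δ P i j ≈ᴹ Δ Q i j
    inside i<γ j<γ = subst₂ (λ i j → Δ P i j ≈ᴹ Δ Q i j)
      (Fin.toℕ-fromℕ< i<γ) (Fin.toℕ-fromℕ< j<γ) (ΔP≈ΔQ (fromℕ< i<γ) (fromℕ< j<γ))

    -- `m` and `n` bound the distances from `i` and `j` up to `γ` and make the recursion structural.
    go : ∀ m n i j → γ ≤ m + i → γ ≤ n + j → P i j ≈ᴹ Q i j
    go zero    n       i j p q = outside (inj₁ p)
    go (suc m) zero    i j p q = outside (inj₂ q)
    go (suc m) (suc n) i j p q with i ℕ.<? γ | j ℕ.<? γ
    ... | no i≮γ  | _       = outside (inj₁ (ℕ.≮⇒≥ i≮γ))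
    ... | yes _   | no j≮γ  = outside (inj₂ (ℕ.≮⇒≥ j≮γ))
    ... | yes i<γ | yes j<γ = G.∙-cancelʳ _ _ _ (G.∙-cancelʳ _ _ _ (begin
      (P i j - P i (suc j)) - (P (suc i) j - P (suc i) (suc j)) ≈⟨ inside i<γ j<γ ⟩
      (Q i j - Q i (suc j)) - (Q (suc i) j - Q (suc i) (suc j))
        ≈⟨ -‿cong₂ (+ᴹ-congˡ (-ᴹ‿cong (go (suc m) n i (suc j) p q′)))
                   (-‿cong₂ (go m (suc n) (suc i) j p′ q) (go m n (suc i) (suc j) p′ q′)) ⟨
      (Q i j - P i (suc j)) - (P (suc i) j - P (suc i) (suc j)) ∎))
      where
      p′ : γ ≤ m + suc i
      p′ = subst (γ ≤_) (sym (ℕ.+-suc m i)) p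
      q′ : γ ≤ n + suc j
      q′ = subst (γ ≤_) (sym (ℕ.+-suc n j)) q

  infix 8 _^⊔
  _^⊔ : Grid → Grid
  (Q ^⊔) i j = Q i (i ℕ.⊔ j)

  ^⊔-vanishing : ∀ {Q} → Vanishing Q → Vanishing (Q ^⊔)
  ^⊔-vanishing Q≈0 (inj₁ γ≤i) = Q≈0 (inj₁ γ≤i)
  ^⊔-vanishing Q≈0 {i} {j} (inj₂ γ≤j) = Q≈0 (inj₂ (ℕ.≤-trans γ≤j (ℕ.m≤n⊔m i j)))

  -- The three positions relative to the diagonal give the three shapes of barred relation. Above
  -- it, the maximum is the second index at all four corners; below it, the first, so each row
  -- cancels; on it, only row `i` survives.
  Δ-^⊔-< : ∀ Q {i j} → i < j → Δ (Q ^⊔) i j ≈ᴹ Δ Q i j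
  Δ-^⊔-< Q i<j rewrite ℕ.m≤n⇒m⊔n≡n i<j | ℕ.m≤n⇒m⊔n≡n (ℕ.<⇒≤ i<j)
                     | ℕ.m≤n⇒m⊔n≡n (ℕ.m≤n⇒m≤1+n (ℕ.<⇒≤ i<j)) = ≈ᴹ-refl

  Δ-^⊔-> : ∀ Q {i j} → j < i → Δ (Q ^⊔) i j ≈ᴹ 0ᴹ
  Δ-^⊔-> Q j<i rewrite ℕ.m≥n⇒m⊔n≡m j<i | ℕ.m≥n⇒m⊔n≡m (ℕ.<⇒≤ j<i)
                     | ℕ.m≥n⇒m⊔n≡m (ℕ.m≤n⇒m≤1+n (ℕ.<⇒≤ j<i)) = x-x-[y-y]≈0 _ _

  Δ-^⊔-≡ : ∀ Q i → Δ (Q ^⊔) i i ≈ᴹ Q i i - Q i (suc i)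
  Δ-^⊔-≡ Q i rewrite ℕ.⊔-idem i | ℕ.m≤n⇒m⊔n≡n (ℕ.n≤1+n i) | ℕ.m≥n⇒m⊔n≡m (ℕ.n≤1+n i) =
    ≈ᴹ-trans (-‿cong₂ ≈ᴹ-refl (-ᴹ‿inverseʳ _)) (x-0≈x _)

-- Equivalence of barred and plain relations

module BarredRelations {r ℓr} (R : CommutativeRing r ℓr) (γ : ℕ)
  {m ℓm} (N : Module R m ℓm) {q : Operad.⟦_⟧ (Free R (𝔊 γ)) 2 → Module.Carrierᴹ N}
  (q-linear : IsLinear R (Operad.component (Free R (𝔊 γ)) 2) N q) where

  open Module N
  open SetoidReasoning ≈ᴹ-setoid
  open Differences N γ
  open Rewriting γ using (_∨_; toℕ-∨)
  private
    module F = Operad (Free R (𝔊 γ))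
    module q = IsLinear q-linear

  ∑≥-telescope : (f : Fin γ → F.⟦ 2 ⟧) (g : ℕ → Carrierᴹ) →
                 (∀ b → q (f b) ≈ᴹ g (toℕ b) - g (suc (toℕ b))) →
                 ∀ a → q (∑≥ R γ a f) ≈ᴹ g (toℕ a) - g γ
  ∑≥-telescope f g f≈ a = go γ 0 id (λ _ → refl) refl
    where
    ∑ : List (Fin γ) → F.⟦ 2 ⟧
    ∑ xs = foldr F._+ᴹ_ F.0ᴹ (map f (filter (a Fin.≤?_) xs))

    -- `h` enumerates the indices from `k` on. While `k` is below `a` the filter drops the first one
    -- and the sum still starts at `a`, hence the lower end `k ℕ.⊔ toℕ a`.
    go : ∀ n k (h : Fin n → Fin γ) → (∀ i → toℕ (h i) ≡ k + toℕ i) → k + n ≡ γ →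
         q (∑ (tabulate h)) ≈ᴹ g (k ℕ.⊔ toℕ a) - g γ
    go zero k h _ k+0≡γ = begin
      q F.0ᴹ                       ≈⟨ q.0-homo ⟩
      0ᴹ                           ≈⟨ -ᴹ‿inverseʳ _ ⟨
      g γ - g γ                    ≡⟨ cong (λ i → g i - g γ) γ≡ ⟩
      g (k ℕ.⊔ toℕ a) - g γ        ∎
      where
      k≡γ : k ≡ γ
      k≡γ = trans (sym (ℕ.+-identityʳ k)) k+0≡γ
      γ≡ : γ ≡ k ℕ.⊔ toℕ a
      γ≡ = sym (trans (ℕ.m≥n⇒m⊔n≡m (subst (toℕ a ≤_) (sym k≡γ) (ℕ.<⇒≤ (Fin.toℕ<n a)))) k≡γ)
    go (suc n) k h h≡ eq with a Fin.≤? h zero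
    ... | yes a≤ = begin
      q (∑ (tabulate h))
        ≡⟨ cong (λ xs → q (foldr F._+ᴹ_ F.0ᴹ (map f xs))) (filter-accept (a Fin.≤?_) a≤) ⟩
      q (f (h zero) F.+ᴹ ∑ (tabulate (h ∘ suc)))
        ≈⟨ q.+-homo _ _ ⟩
      q (f (h zero)) +ᴹ q (∑ (tabulate (h ∘ suc)))
        ≈⟨ +ᴹ-cong (f≈ (h zero)) (go n (suc k) (h ∘ suc) h≡′ (trans (sym (ℕ.+-suc k n)) eq)) ⟩
      (g (toℕ (h zero)) - g (suc (toℕ (h zero)))) +ᴹ (g (suc k ℕ.⊔ toℕ a) - g γ)
        ≡⟨ cong₂ (λ i j → (g i - g (suc i)) +ᴹ (g j - g γ)) h0≡k
             (ℕ.m≥n⇒m⊔n≡m (ℕ.m≤n⇒m≤1+n a≤k)) ⟩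
      (g k - g (suc k)) +ᴹ (g (suc k) - g γ)
        ≈⟨ telescope _ _ _ ⟩
      g k - g γ
        ≡⟨ cong (λ i → g i - g γ) (ℕ.m≥n⇒m⊔n≡m a≤k) ⟨
      g (k ℕ.⊔ toℕ a) - g γ ∎
      where
      h0≡k : toℕ (h zero) ≡ k
      h0≡k = trans (h≡ zero) (ℕ.+-identityʳ k)
      a≤k : toℕ a ≤ k
      a≤k = subst (toℕ a ≤_) h0≡k a≤
      h≡′ : ∀ i → toℕ (h (suc i)) ≡ suc k + toℕ i
      h≡′ i = trans (h≡ (suc i)) (ℕ.+-suc k _)
    ... | no a≰ = begin
      q (∑ (tabulate h))
        ≡⟨ cong (λ xs → q (foldr F._+ᴹ_ F.0ᴹ (map f xs))) (filter-reject (a Fin.≤?_) a≰) ⟩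
      q (∑ (tabulate (h ∘ suc)))
        ≈⟨ go n (suc k) (h ∘ suc) h≡′ (trans (sym (ℕ.+-suc k n)) eq) ⟩
      g (suc k ℕ.⊔ toℕ a) - g γ
        ≡⟨ cong (λ i → g i - g γ)
             (trans (ℕ.m≤n⇒m⊔n≡n k<a) (sym (ℕ.m≤n⇒m⊔n≡n (ℕ.<⇒≤ k<a)))) ⟩
      g (k ℕ.⊔ toℕ a) - g γ ∎
      where
      k<a : k < toℕ a
      k<a = subst (_< toℕ a) (trans (h≡ zero) (ℕ.+-identityʳ k)) (ℕ.≰⇒> a≰)
      h≡′ : ∀ i → toℕ (h (suc i)) ≡ suc k + toℕ i
      h≡′ i = trans (h≡ (suc i)) (ℕ.+-suc k _)

  -- With the value 0 from `γ` on, both cases of `bar` become one difference of consecutive values.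
  zeroExtension : (Fin γ → F.⟦ 1 ⟧) → ℕ → F.⟦ 1 ⟧
  zeroExtension e i with i ℕ.<? γ
  ... | yes i<γ = e (fromℕ< i<γ)
  ... | no  _   = F.0ᴹ

  zeroExtension-toℕ : ∀ e a → zeroExtension e (toℕ a) ≡ e a
  zeroExtension-toℕ e a with toℕ a ℕ.<? γ
  ... | yes a<γ = cong e (Fin.fromℕ<-toℕ a a<γ)
  ... | no  a≮γ = contradiction (Fin.toℕ<n a) a≮γ

  zeroExtension-≥ : ∀ e {i} → γ ≤ i → zeroExtension e i ≡ F.0ᴹ
  zeroExtension-≥ e {i} γ≤i with i ℕ.<? γ
  ... | yes i<γ = contradiction i<γ (ℕ.≤⇒≯ γ≤i)
  ... | no  _   = refl

  bar-difference : ∀ e a → bar R γ e a F.≈ᴹ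
                   zeroExtension e (toℕ a) F.-ᴹ zeroExtension e (suc (toℕ a))
  bar-difference e a rewrite zeroExtension-toℕ e a with suc (toℕ a) ℕ.<? γ
  ... | yes _ = F.Component.≈ᴹ-refl
  ... | no  _ = F.Component.≈ᴹ-sym (Differences.x-0≈x (F.component 1) γ (e a))

  -- Each relation compares doubly indexed families of products. Bundling plain form, barred form
  -- and grid lets the change of basis be done once per shape of relation.
  record ProductGrid : Set (r ⊔ ℓr ⊔ m ⊔ ℓm) where
    field
      plain barred : Fin γ → Fin γ → F.⟦ 2 ⟧
      grid         : Grid
      grid-plain   : ∀ a b → grid (toℕ a) (toℕ b) ≈ᴹ q (plain a b)
      Δ-barred     : ∀ a b → q (barred a b) ≈ᴹ Δ grid (toℕ a) (toℕ b)
      vanishing    : Vanishing grid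

  open ProductGrid

  -- Bilinearity expands a product of two differences into the four terms of `Δ`.
  products : Fin 2 → (Fin γ → 𝔊 γ) → (Fin γ → 𝔊 γ) → ProductGrid
  products h c d = record
    { plain = λ a b → e a F.∘⟨ h ⟩ e′ b
    ; barred = λ a b → bar R γ e a F.∘⟨ h ⟩ bar R γ e′ b
    ; grid = λ i j → E i ∙ E′ j
    ; grid-plain = λ a b → ≈ᴹ-reflexive
        (cong₂ _∙_ (zeroExtension-toℕ e a) (zeroExtension-toℕ e′ b))
    ; Δ-barred = λ a b → let i = toℕ a ; j = toℕ b in begin
        bar R γ e a ∙ bar R γ e′ b
          ≈⟨ q.f-cong (F.∘-cong h (bar-difference e a) (bar-difference e′ b)) ⟩
        (E i F.-ᴹ E (suc i)) ∙ (E′ j F.-ᴹ E′ (suc j))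
          ≈⟨ ∙-minusˡ (E i) (E (suc i)) (E′ j F.-ᴹ E′ (suc j)) ⟩
        (E i ∙ (E′ j F.-ᴹ E′ (suc j))) - (E (suc i) ∙ (E′ j F.-ᴹ E′ (suc j)))
          ≈⟨ -‿cong₂ (∙-minusʳ (E i) (E′ j) (E′ (suc j)))
                     (∙-minusʳ (E (suc i)) (E′ j) (E′ (suc j))) ⟩
        Δ (λ i j → E i ∙ E′ j) i j ∎
    ; vanishing = λ
        { {i} {j} (inj₁ γ≤i) → ≈ᴹ-trans (≈ᴹ-reflexive (cong (_∙ E′ j) (zeroExtension-≥ e γ≤i)))
            (IsLinear.0-homo (∙-linearˡ (E′ j)))
        ; {i} {j} (inj₂ γ≤j) → ≈ᴹ-trans (≈ᴹ-reflexive (cong (E i ∙_) (zeroExtension-≥ e′ γ≤j)))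
            (IsLinear.0-homo (∙-linearʳ (E i))) }
    }
    where
    e e′ : Fin γ → F.⟦ 1 ⟧
    e = corolla R (𝔊 γ) ∘ c
    e′ = corolla R (𝔊 γ) ∘ d
    E E′ : ℕ → F.⟦ 1 ⟧
    E = zeroExtension e
    E′ = zeroExtension e′

    infix 7 _∙_
    _∙_ : F.⟦ 1 ⟧ → F.⟦ 1 ⟧ → Carrierᴹ
    x ∙ y = q (x F.∘⟨ h ⟩ y)

    ∙-linearˡ : ∀ y → IsLinear R (F.component 1) N (_∙ y)
    ∙-linearˡ y = ∘-linear R (F.component 1) (F.component 2) N q-linear (F.linearˡ h y)
    ∙-linearʳ : ∀ x → IsLinear R (F.component 1) N (x ∙_)
    ∙-linearʳ x = ∘-linear R (F.component 1) (F.component 2) N q-linear (F.linearʳ x h)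

    ∙-minusˡ : ∀ x y z → (x F.-ᴹ y) ∙ z ≈ᴹ (x ∙ z) - (y ∙ z)
    ∙-minusˡ x y z = ≈ᴹ-trans (IsLinear.+-homo (∙-linearˡ z) x (F.-ᴹ y))
      (+ᴹ-congˡ (IsLinear.neg-homo (∙-linearˡ z) y))
    ∙-minusʳ : ∀ x y z → x ∙ (y F.-ᴹ z) ≈ᴹ (x ∙ y) - (x ∙ z)
    ∙-minusʳ x y z = ≈ᴹ-trans (IsLinear.+-homo (∙-linearʳ x) y (F.-ᴹ z))
      (+ᴹ-congˡ (IsLinear.neg-homo (∙-linearʳ x) z))

  -- For relations whose two sides carry the indices in opposite orders; `Δ` is symmetric in its two
  -- directions.
  transpose : ProductGrid → ProductGrid
  transpose P = record
    { plain = λ a b → plain P b a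
    ; barred = λ a b → barred P b a
    ; grid = λ i j → grid P j i
    ; grid-plain = λ a b → grid-plain P b a
    ; Δ-barred = λ a b → ≈ᴹ-trans (Δ-barred P b a) (-‿interchange _ _ _ _)
    ; vanishing = λ p → vanishing P (swap p)
    }

  -- The shape of all barred relations except the family `⊣∘₁⊢`: each of four pairs of families
  -- contributes a vanishing, an equality and a sum.
  record BarredMaxRule (P Q : ProductGrid) : Set ℓm where
    field
      below    : ∀ {a b} → a Fin.< b → q (barred P b a) ≈ᴹ 0ᴹ
      above    : ∀ {a b} → a Fin.< b → q (barred P a b) ≈ᴹ q (barred Q a b)
      diagonal : ∀ a → q (barred P a a) ≈ᴹ q (∑≥ R γ a (λ b → barred Q b a))

  MaxRule : (P Q : ProductGrid) → Set ℓm
  MaxRule P Q = ∀ a b → q (plain P a b) ≈ᴹ q (plain Q a (a ∨ b))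

  -- Summation over the first index telescopes one of the two differences in `Δ`, and its end at `γ`
  -- vanishes.
  column-sum : ∀ Q a → q (∑≥ R γ a (λ b → barred Q b a)) ≈ᴹ Δ (grid Q ^⊔) (toℕ a) (toℕ a)
  column-sum Q a = begin
    q (∑≥ R γ a (λ b → barred Q b a))
      ≈⟨ ∑≥-telescope _ (λ i → grid Q i j - grid Q i (suc j)) (λ b → Δ-barred Q b a) a ⟩
    (grid Q j j - grid Q j (suc j)) - (grid Q γ j - grid Q γ (suc j))
      ≈⟨ -‿cong₂ ≈ᴹ-refl (-‿cong₂ (vanishing Q (inj₁ ℕ.≤-refl)) (vanishing Q (inj₁ ℕ.≤-refl))) ⟩
    (grid Q j j - grid Q j (suc j)) - (0ᴹ - 0ᴹ)
      ≈⟨ ≈ᴹ-trans (-‿cong₂ ≈ᴹ-refl (-ᴹ‿inverseʳ 0ᴹ)) (x-0≈x _) ⟩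
    grid Q j j - grid Q j (suc j)
      ≈⟨ Δ-^⊔-≡ (grid Q) j ⟨
    Δ (grid Q ^⊔) j j ∎
    where j = toℕ a

  -- The barred rule says, case by case, that `grid P` and `grid Q ^⊔` have the same mixed
  -- differences; `Δ-injective` then identifies the grids.
  maxRule : ∀ {P Q} → BarredMaxRule P Q → MaxRule P Q
  maxRule {P} {Q} rule a b = begin
    q (plain P a b)                      ≈⟨ grid-plain P a b ⟨
    grid P (toℕ a) (toℕ b)
      ≈⟨ Δ-injective (vanishing P) (^⊔-vanishing (vanishing Q)) ΔP≈ _ _ ⟩
    grid Q (toℕ a) (toℕ a ℕ.⊔ toℕ b)     ≡⟨ cong (grid Q (toℕ a)) (toℕ-∨ a b) ⟨
    grid Q (toℕ a) (toℕ (a ∨ b))         ≈⟨ grid-plain Q a (a ∨ b) ⟩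
    q (plain Q a (a ∨ b))                ∎
    where
    open BarredMaxRule rule
    ΔP≈ : ∀ a b → Δ (grid P) (toℕ a) (toℕ b) ≈ᴹ Δ (grid Q ^⊔) (toℕ a) (toℕ b)
    ΔP≈ a b with Fin.<-cmp a b
    ... | tri< a<b _ _ = begin
      Δ (grid P) (toℕ a) (toℕ b)       ≈⟨ Δ-barred P a b ⟨
      q (barred P a b)                 ≈⟨ above a<b ⟩
      q (barred Q a b)                 ≈⟨ Δ-barred Q a b ⟩
      Δ (grid Q) (toℕ a) (toℕ b)       ≈⟨ Δ-^⊔-< (grid Q) a<b ⟨
      Δ (grid Q ^⊔) (toℕ a) (toℕ b)    ∎
    ... | tri≈ _ refl _ =
      ≈ᴹ-trans (≈ᴹ-sym (Δ-barred P a a)) (≈ᴹ-trans (diagonal a) (column-sum Q a))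
    ... | tri> _ _ b<a =
      ≈ᴹ-trans (≈ᴹ-sym (Δ-barred P a b)) (≈ᴹ-trans (below b<a) (≈ᴹ-sym (Δ-^⊔-> (grid Q) b<a)))

  barredMaxRule : ∀ {P Q} → MaxRule P Q → BarredMaxRule P Q
  barredMaxRule {P} {Q} rule = record
    { below    = λ {a} {b} a<b → ≈ᴹ-trans (ΔP≈ b a) (Δ-^⊔-> (grid Q) a<b)
    ; above    = λ {a} {b} a<b →
        ≈ᴹ-trans (ΔP≈ a b) (≈ᴹ-trans (Δ-^⊔-< (grid Q) a<b) (≈ᴹ-sym (Δ-barred Q a b)))
    ; diagonal = λ a → ≈ᴹ-trans (ΔP≈ a a) (≈ᴹ-sym (column-sum Q a))
    }
    where
    inside : ∀ a b → grid P (toℕ a) (toℕ b) ≈ᴹ (grid Q ^⊔) (toℕ a) (toℕ b)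
    inside a b = begin
      grid P (toℕ a) (toℕ b)               ≈⟨ grid-plain P a b ⟩
      q (plain P a b)                      ≈⟨ rule a b ⟩
      q (plain Q a (a ∨ b))                ≈⟨ grid-plain Q a (a ∨ b) ⟨
      grid Q (toℕ a) (toℕ (a ∨ b))         ≡⟨ cong (grid Q (toℕ a)) (toℕ-∨ a b) ⟩
      grid Q (toℕ a) (toℕ a ℕ.⊔ toℕ b)     ∎

    -- Extended beyond `Fin γ`, because `Δ` at the last index also reads index `γ`.
    P≈ : ∀ i j → grid P i j ≈ᴹ (grid Q ^⊔) i j
    P≈ = grid-ext (vanishing P) (^⊔-vanishing (vanishing Q)) inside

    ΔP≈ : ∀ a b → q (barred P a b) ≈ᴹ Δ (grid Q ^⊔) (toℕ a) (toℕ b)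
    ΔP≈ a b = ≈ᴹ-trans (Δ-barred P a b) (Δ-cong {Q = grid Q ^⊔} P≈ (toℕ a) (toℕ b))

  EqualRule BarredEqualRule : (P Q : ProductGrid) → Set ℓm
  EqualRule P Q = ∀ a b → q (plain P a b) ≈ᴹ q (plain Q a b)
  BarredEqualRule P Q = ∀ a b → q (barred P a b) ≈ᴹ q (barred Q a b)

  equalRule : ∀ {P Q} → BarredEqualRule P Q → EqualRule P Q
  equalRule {P} {Q} rule a b = begin
    q (plain P a b)           ≈⟨ grid-plain P a b ⟨
    grid P (toℕ a) (toℕ b)    ≈⟨ Δ-injective (vanishing P) (vanishing Q) ΔP≈ΔQ _ _ ⟩
    grid Q (toℕ a) (toℕ b)    ≈⟨ grid-plain Q a b ⟩
    q (plain Q a b)           ∎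
    where
    ΔP≈ΔQ : ∀ a b → Δ (grid P) (toℕ a) (toℕ b) ≈ᴹ Δ (grid Q) (toℕ a) (toℕ b)
    ΔP≈ΔQ a b = ≈ᴹ-trans (≈ᴹ-sym (Δ-barred P a b)) (≈ᴹ-trans (rule a b) (Δ-barred Q a b))

  barredEqualRule : ∀ {P Q} → EqualRule P Q → BarredEqualRule P Q
  barredEqualRule {P} {Q} rule a b = begin
    q (barred P a b)                  ≈⟨ Δ-barred P a b ⟩
    Δ (grid P) (toℕ a) (toℕ b)        ≈⟨ Δ-cong {Q = grid Q} P≈Q _ _ ⟩
    Δ (grid Q) (toℕ a) (toℕ b)        ≈⟨ Δ-barred Q a b ⟨
    q (barred Q a b)                  ∎
    where
    P≈Q : ∀ i j → grid P i j ≈ᴹ grid Q i j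
    P≈Q = grid-ext (vanishing P) (vanishing Q) (λ a b →
      ≈ᴹ-trans (grid-plain P a b) (≈ᴹ-trans (rule a b) (≈ᴹ-sym (grid-plain Q a b))))

  -- One field for each rewriting rule of `_⇒_`, on trees with three leaves.
  record WordRules : Set ℓm where
    field
      ⊣∘₁⊢-rule : EqualRule (products zero ⊣ ⊢) (transpose (products (suc zero) ⊢ ⊣))
      ⊢∘₁⊢-rule : MaxRule (products zero ⊢ ⊢) (transpose (products (suc zero) ⊢ ⊢))
      ⊢∘₁⊣-rule : MaxRule (products zero ⊢ ⊣) (products (suc zero) ⊢ ⊢)
      ⊣∘₂⊣-rule : MaxRule (products (suc zero) ⊣ ⊣) (transpose (products zero ⊣ ⊣))
      ⊣∘₂⊢-rule : MaxRule (products (suc zero) ⊣ ⊢) (products zero ⊣ ⊣)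

  -- The map `q` serves twice: for evaluation as words the rules are checked and give annihilation;
  -- for the projection to the quotient annihilation holds by construction and gives the rules.
  Annihilates : Set (r ⊔ ℓm)
  Annihilates = ∀ {x} → Relation R γ 2 x → q x ≈ᴹ 0ᴹ

  private
    q-minus : ∀ x y → q (x F.-ᴹ y) ≈ᴹ q x - q y
    q-minus x y = ≈ᴹ-trans (q.+-homo x (F.-ᴹ y)) (+ᴹ-congˡ (q.neg-homo y))

  annihilates⇒rules : Annihilates → WordRules
  annihilates⇒rules kill = record
    { ⊣∘₁⊢-rule = equalRule {products zero ⊣ ⊢} {transpose (products (suc zero) ⊢ ⊣)}
        (λ a b → equal (⊣∘₁⊢ a b))
    ; ⊢∘₁⊢-rule = maxRule {products zero ⊢ ⊢} {transpose (products (suc zero) ⊢ ⊢)} record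
        { below    = λ a<b → kill (⊢b∘₁⊢a a<b)
        ; above    = λ a<b → equal (⊢a∘₁⊢b a<b)
        ; diagonal = λ a → equal (⊢a∘₁⊢a a) }
    ; ⊢∘₁⊣-rule = maxRule {products zero ⊢ ⊣} {products (suc zero) ⊢ ⊢} record
        { below    = λ a<b → kill (⊢b∘₁⊣a a<b)
        ; above    = λ a<b → equal (⊢a∘₁⊣b a<b)
        ; diagonal = λ a → equal (⊢a∘₁⊣a a) }
    ; ⊣∘₂⊣-rule = maxRule {products (suc zero) ⊣ ⊣} {transpose (products zero ⊣ ⊣)} record
        { below    = λ a<b → kill (⊣b∘₂⊣a a<b)
        -- The relations put the `∘₁` product first, while this rule is oriented from `∘₂` to `∘₁`.
        ; above    = λ a<b → ≈ᴹ-sym (equal (⊣b∘₁⊣a a<b))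
        ; diagonal = λ a → ≈ᴹ-sym (equal (⊣a∘₂⊣a a)) }
    ; ⊣∘₂⊢-rule = maxRule {products (suc zero) ⊣ ⊢} {products zero ⊣ ⊣} record
        { below    = λ a<b → kill (⊣b∘₂⊢a a<b)
        ; above    = λ a<b → ≈ᴹ-sym (equal (⊣a∘₁⊣b a<b))
        ; diagonal = λ a → ≈ᴹ-sym (equal (⊣a∘₂⊢a a)) }
    }
    where
    equal : ∀ {x y} → Relation R γ 2 (x F.-ᴹ y) → q x ≈ᴹ q y
    equal {x} {y} rel = x-y≈0⇒x≈y (≈ᴹ-trans (≈ᴹ-sym (q-minus x y)) (kill rel))

  rules⇒annihilates : WordRules → Annihilates
  rules⇒annihilates rules = kill
    where
    open WordRules rules
    module ⊢∘₁⊢ = BarredMaxRule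
      (barredMaxRule {products zero ⊢ ⊢} {transpose (products (suc zero) ⊢ ⊢)} ⊢∘₁⊢-rule)
    module ⊢∘₁⊣ = BarredMaxRule
      (barredMaxRule {products zero ⊢ ⊣} {products (suc zero) ⊢ ⊢} ⊢∘₁⊣-rule)
    module ⊣∘₂⊣ = BarredMaxRule
      (barredMaxRule {products (suc zero) ⊣ ⊣} {transpose (products zero ⊣ ⊣)} ⊣∘₂⊣-rule)
    module ⊣∘₂⊢ = BarredMaxRule
      (barredMaxRule {products (suc zero) ⊣ ⊢} {products zero ⊣ ⊣} ⊣∘₂⊢-rule)

    zeroed : ∀ x y → q x ≈ᴹ q y → q (x F.-ᴹ y) ≈ᴹ 0ᴹ
    zeroed x y p = ≈ᴹ-trans (q-minus x y) (x≈y⇒x-y≈0 p)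

    kill : Annihilates
    kill (⊣∘₁⊢ a a′) = zeroed _ _ (barredEqualRule
      {products zero ⊣ ⊢} {transpose (products (suc zero) ⊢ ⊣)} ⊣∘₁⊢-rule a a′)
    kill (⊢b∘₁⊢a a<b) = ⊢∘₁⊢.below a<b
    kill (⊣b∘₂⊣a a<b) = ⊣∘₂⊣.below a<b
    kill (⊢b∘₁⊣a a<b) = ⊢∘₁⊣.below a<b
    kill (⊣b∘₂⊢a a<b) = ⊣∘₂⊢.below a<b
    kill (⊢a∘₁⊢b a<b) = zeroed _ _ (⊢∘₁⊢.above a<b)
    kill (⊣b∘₁⊣a a<b) = zeroed _ _ (≈ᴹ-sym (⊣∘₂⊣.above a<b))
    kill (⊢a∘₁⊣b a<b) = zeroed _ _ (⊢∘₁⊣.above a<b)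
    kill (⊣a∘₁⊣b a<b) = zeroed _ _ (≈ᴹ-sym (⊣∘₂⊢.above a<b))
    kill (⊢a∘₁⊢a a) = zeroed _ _ (⊢∘₁⊢.diagonal a)
    kill (⊣a∘₂⊣a a) = zeroed _ _ (≈ᴹ-sym (⊣∘₂⊣.diagonal a))
    kill (⊢a∘₁⊣a a) = zeroed _ _ (⊢∘₁⊣.diagonal a)
    kill (⊣a∘₂⊢a a) = zeroed _ _ (≈ᴹ-sym (⊣∘₂⊢.diagonal a))

-- Evaluation as a morphism to the word operad

module DiasPresentation {r ℓr} (R : CommutativeRing r ℓr) (γ : ℕ) where
  open Trees (𝔊 γ)
  open Words γ using (wordOperad)
  open Rewriting γ
  private
    module F = Operad (Free R (𝔊 γ))
    module W = Operad (WordOperad R γ)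
    module Q = Operad (quotient R (Free R (𝔊 γ)) (Relation R γ))
    Tree′ Word′ : ℕ → Set
    Tree′ k = SetOperad.OfArity treeOperad (suc k)
    Word′ k = SetOperad.OfArity wordOperad (suc k)

    Σ-≡ : {A : Set} {f : A → ℕ} {n : ℕ} {x y : Σ A (λ a → f a ≡ n)} → proj₁ x ≡ proj₁ y → x ≡ y
    Σ-≡ {x = a , p} {.a , q} refl = cong (a ,_) (ℕ.≡-irrelevant p q)

    basis-≡ : ∀ {k} {x y : Word′ k} → proj₁ x ≡ proj₁ y → basis {R = R} x W.≈ᴹ basis y
    basis-≡ p = W.Component.≈ᴹ-reflexive (cong basis (Σ-≡ p))

    graded : (t : Tree) → Tree′ (ℕ.pred (leaves t))
    graded t = t , sym (ℕ.suc-pred _ {{ℕ.>-nonZero (leaves>0 t)}})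

  wordOf : ∀ {k} → Tree′ k → Word′ k
  wordOf (t , p) = eval t , trans (arity-eval t) p

  φ : ∀ k → F.⟦ k ⟧ → W.⟦ k ⟧
  φ k = extend R (W.component k) (basis ∘ wordOf)

  φ-linear : ∀ k → IsLinear R (F.component k) (W.component k) (φ k)
  φ-linear k = extend-linear R (W.component k) (basis ∘ wordOf)

  -- Both sides are bilinear, and on basis trees this is `eval-graft`.
  φ-∘ : ∀ {k l} (u : F.⟦ k ⟧) i (v : F.⟦ l ⟧) →
        φ (k + l) (u F.∘⟨ i ⟩ v) W.≈ᴹ φ k u W.∘⟨ i ⟩ φ l v
  φ-∘ (basis (t , p)) i (basis (u , _)) =
    basis-≡ (eval-graft t u (subst (toℕ i <_) (sym p) (Fin.toℕ<n i)))
  φ-∘ (basis x) i 𝟘       = ≋-refl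
  φ-∘ (basis x) i (v ⊕ w) = ⊕-cong (φ-∘ (basis x) i v) (φ-∘ (basis x) i w)
  φ-∘ (basis x) i (s ⊙ v) = ⊙-cong (CommutativeRing.refl R) (φ-∘ (basis x) i v)
  φ-∘ 𝟘         i v       = ≋-refl
  φ-∘ (u ⊕ u′)  i v       = ⊕-cong (φ-∘ u i v) (φ-∘ u′ i v)
  φ-∘ (s ⊙ u)   i v       = ⊙-cong (CommutativeRing.refl R) (φ-∘ u i v)

  private
    module φBarred = BarredRelations R γ (W.component 2) (φ-linear 2)

    eval-≡ : ∀ t u {k} {p : length (eval t) ≡ suc k} {q : length (eval u) ≡ suc k} →
             pointed t ≡ pointed u → basis {R = R} (eval t , p) W.≈ᴹ basis (eval u , q)
    eval-≡ t u e = basis-≡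
      (trans (eval-pointed t) (trans (cong encode e) (sym (eval-pointed u))))

    -- Through `pointed` both trees compute to the same pair, with `a ∨ b` left symbolic; hence
    -- `refl`.
    φ-rules : φBarred.WordRules
    φ-rules = record
      { ⊣∘₁⊢-rule = λ a b → eval-≡
          (node (⊣ a) (node (⊢ b) leaf leaf) leaf)
          (node (⊢ b) leaf (node (⊣ a) leaf leaf)) refl
      ; ⊢∘₁⊢-rule = λ a b → eval-≡
          (node (⊢ a) (node (⊢ b) leaf leaf) leaf)
          (node (⊢ (a ∨ b)) leaf (node (⊢ a) leaf leaf)) refl
      ; ⊢∘₁⊣-rule = λ a b → eval-≡
          (node (⊢ a) (node (⊣ b) leaf leaf) leaf)
          (node (⊢ a) leaf (node (⊢ (a ∨ b)) leaf leaf)) refl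
      ; ⊣∘₂⊣-rule = λ a b → eval-≡
          (node (⊣ a) leaf (node (⊣ b) leaf leaf))
          (node (⊣ (a ∨ b)) (node (⊣ a) leaf leaf) leaf) refl
      ; ⊣∘₂⊢-rule = λ a b → eval-≡
          (node (⊣ a) leaf (node (⊢ b) leaf leaf))
          (node (⊣ a) (node (⊣ (a ∨ b)) leaf leaf) leaf) refl
      }

    φ-relation : ∀ {k u} → Relation R γ k u → φ k u W.≈ᴹ W.0ᴹ
    φ-relation {0} ()
    φ-relation {1} ()
    φ-relation {2} rel = φBarred.rules⇒annihilates φ-rules rel
    φ-relation {suc (suc (suc _))} ()

  -- The kernel of `φ` is closed under all ideal operations because `φ` is a linear morphism of
  -- operads.
  φ-ideal : ∀ {k u} → Ideal R (Free R (𝔊 γ)) (Relation R γ) k u → φ k u W.≈ᴹ W.0ᴹ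
  φ-ideal (gen rel)         = φ-relation rel
  φ-ideal (compˡ {k} {l} {x} i y p) = ≋-trans (φ-∘ x i y)
    (≋-trans (IsLinear.f-cong (W.linearˡ i (φ l y)) {φ k x} {𝟘} (φ-ideal p))
      (IsLinear.0-homo (W.linearˡ i (φ l y))))
  φ-ideal (compʳ {k} {l} {y} x i p) = ≋-trans (φ-∘ x i y)
    (≋-trans (IsLinear.f-cong (W.linearʳ (φ k x) i) {φ l y} {𝟘} (φ-ideal p))
      (IsLinear.0-homo (W.linearʳ (φ k x) i)))
  φ-ideal 0∈                = ≋-refl
  φ-ideal (+∈ p q)          = ≋-trans (⊕-cong (φ-ideal p) (φ-ideal q)) (⊕-identityˡ 𝟘)
  φ-ideal (*∈ s p)          = ≋-trans (⊙-cong (CommutativeRing.refl R) (φ-ideal p)) (⊙-zeroʳ s)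
  φ-ideal {k} (resp e p)    = ≋-trans (IsLinear.f-cong (φ-linear k) (≋-sym e)) (φ-ideal p)

  φ-cong : ∀ {k} {u v : F.⟦ k ⟧} → u Q.≈ᴹ v → φ k u W.≈ᴹ φ k v
  φ-cong {k} p = Differences.x-y≈0⇒x≈y (W.component k) γ (φ-ideal p)

  -- The image of evaluation

  private
    IsGenerated : ∀ k → W.⟦ k ⟧ → Set (r ⊔ ℓr)
    IsGenerated = Generated R (WordOperad R γ) (DiasGenerator R γ)

    -- The index computed by a composition and the index asked for agree, both being fixed by the
    -- length of `w`.
    reindex : ∀ (P : ∀ k → W.⟦ k ⟧ → Set (r ⊔ ℓr))
              {k n w} {p : length w ≡ suc n} (q : length w ≡ suc k) →
              P n (basis (w , p)) → P k (basis (w , q))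
    reindex P {p = p} q x with refl ← ℕ.suc-injective (trans (sym p) q) =
      subst (λ e → P _ (basis (_ , e))) (ℕ.≡-irrelevant p q) x

    word-generated : ∀ s → IsGenerated 1 (basis (⟦ s ⟧ᵍ , ⟦⟧ᵍ-binary s))
    word-generated (⊣ a) = gen (word∈ (⊣ a))
    word-generated (⊢ a) = gen (word∈ (⊢ a))

    eval-generated : ∀ t {k} (p : length (eval t) ≡ suc k) → IsGenerated k (basis (eval t , p))
    eval-generated leaf refl = unit
    eval-generated (node s t u) p = reindex IsGenerated p
      (comp zero
        (comp (suc zero) (word-generated s) (eval-generated u (proj₂ (wordOf (graded u)))))
        (eval-generated t (proj₂ (wordOf (graded t)))))

  φ-generated : ∀ {k} u → IsGenerated k (φ k u)
  φ-generated (basis (t , p)) = eval-generated t _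
  φ-generated 𝟘       = 0∈
  φ-generated (u ⊕ v) = +∈ (φ-generated u) (φ-generated v)
  φ-generated (s ⊙ u) = *∈ s (φ-generated u)

  φ-corolla : ∀ s → φ 1 (corolla R (𝔊 γ) s) W.≈ᴹ word R γ s
  φ-corolla (⊣ a) = basis-≡ (eval-pointed (node (⊣ a) leaf leaf))
  φ-corolla (⊢ a) = basis-≡ (eval-pointed (node (⊢ a) leaf leaf))

  -- A preimage is built by repeating the derivation of membership inside the free operad.
  φ-surjective : ∀ {k w} → IsGenerated k w → ∃ λ u → φ k u W.≈ᴹ w
  φ-surjective (gen (word∈ s)) = corolla R (𝔊 γ) s , φ-corolla s
  φ-surjective unit = F.one , basis-≡ refl
  φ-surjective (comp i g h) =
    let (u , p) = φ-surjective g ; (v , q) = φ-surjective h in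
    u F.∘⟨ i ⟩ v , ≋-trans (φ-∘ u i v) (W.∘-cong i p q)
  φ-surjective 0∈ = F.0ᴹ , ≋-refl
  φ-surjective (+∈ g h) =
    let (u , p) = φ-surjective g ; (v , q) = φ-surjective h in u ⊕ v , ⊕-cong p q
  φ-surjective (*∈ s g) =
    let (u , p) = φ-surjective g in s ⊙ u , ⊙-cong (CommutativeRing.refl R) p
  φ-surjective (resp e g) = let (u , p) = φ-surjective g in u , ≋-trans p e

  -- The kernel of evaluation

  private
    ≋⇒Q : ∀ {k} {u v : F.⟦ k ⟧} → u F.≈ᴹ v → u Q.≈ᴹ v
    ≋⇒Q {k} p = resp (≋-sym (Differences.x≈y⇒x-y≈0 (F.component k) γ p)) 0∈

    quotient-linear : ∀ k → IsLinear R (F.component k) (Q.component k) id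
    quotient-linear k = record
      { f-cong = ≋⇒Q
      ; +-homo = λ _ _ → Q.Component.≈ᴹ-refl
      ; *-homo = λ _ _ → Q.Component.≈ᴹ-refl
      }

    module QBarred = BarredRelations R γ (Q.component 2) (quotient-linear 2)

    Q-rules : QBarred.WordRules
    Q-rules = QBarred.annihilates⇒rules (λ {x} rel →
      -- Equality with 0 in the quotient means that `x - 0` lies in the ideal.
      resp (≋-sym (Differences.x-0≈x (F.component 2) γ x)) (gen rel))
    open QBarred.WordRules Q-rules

    reindex-Q : ∀ {k n t u} {p : leaves t ≡ suc n} {q : leaves u ≡ suc n}
      (p′ : leaves t ≡ suc k) (q′ : leaves u ≡ suc k) →
      basis (t , p) Q.≈ᴹ basis (u , q) → basis (t , p′) Q.≈ᴹ basis (u , q′)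
    reindex-Q {p = p} {q} p′ q′ x with refl ← ℕ.suc-injective (trans (sym p) p′) =
      subst₂ (λ e f → basis (_ , e) Q.≈ᴹ basis (_ , f))
        (ℕ.≡-irrelevant p p′) (ℕ.≡-irrelevant q q′) x

    -- Grafting from the last leaf to the first keeps the earlier positions valid. On the two sides
    -- of a rule between trees with three leaves, it yields the rule for arbitrary subtrees.
    plug : F.⟦ 2 ⟧ → (t u v : Tree) → F.⟦ _ ⟧
    plug x t u v = ((x F.∘⟨ suc (suc zero) ⟩ basis (graded v)) F.∘⟨ suc zero ⟩ basis (graded u))
      F.∘⟨ zero ⟩ basis (graded t)

    plug-cong : ∀ {x y : F.⟦ 2 ⟧} (t u v : Tree) → x Q.≈ᴹ y → plug x t u v Q.≈ᴹ plug y t u v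
    plug-cong t u v p = compˡ-cong zero (basis (graded t))
      (compˡ-cong (suc zero) (basis (graded u))
        (compˡ-cong (suc (suc zero)) (basis (graded v)) p))
      where
      compˡ-cong : ∀ {k l} {x y : F.⟦ k ⟧} i (z : F.⟦ l ⟧) →
                   x Q.≈ᴹ y → x F.∘⟨ i ⟩ z Q.≈ᴹ y F.∘⟨ i ⟩ z
      compˡ-cong {x = x} {y} i z = IsLinear.f-cong (Q.linearˡ i z) {x} {y}

  -- Each rule is a plain relation with subtrees plugged in. For congruence, `node s t u` is the
  -- corolla of `s` with `u` grafted at 1 and then `t` at 0.
  ⇒-sound : ∀ {t u} → t ⇒ u → ∀ {k} (p : leaves t ≡ suc k) (q : leaves u ≡ suc k) →
            basis (t , p) Q.≈ᴹ basis (u , q)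
  ⇒-sound ⇒-refl p q = ≋⇒Q (F.Component.≈ᴹ-reflexive (cong basis (Σ-≡ refl)))
  ⇒-sound (⇒-trans d e) p q =
    let m = trans (sym (leaves-⇒ d)) p in Q.Component.≈ᴹ-trans (⇒-sound d p m) (⇒-sound e m q)
  ⇒-sound (node-cong s {t} {t′} {u} {u′} d e) p q = reindex-Q p q
    (Q.∘-cong {x = corolla R (𝔊 γ) s F.∘⟨ suc zero ⟩ basis (graded u)}
              {x′ = corolla R (𝔊 γ) s F.∘⟨ suc zero ⟩ basis (u′ , u′≡)}
              zero {basis (graded t)} {basis (t′ , t′≡)}
      (Q.∘-cong {x = corolla R (𝔊 γ) s} {x′ = corolla R (𝔊 γ) s} (suc zero)
                {basis (graded u)} {basis (u′ , u′≡)}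
        Q.Component.≈ᴹ-refl (⇒-sound e _ _))
      (⇒-sound d _ _))
    where
    u′≡ : leaves u′ ≡ suc (ℕ.pred (leaves u))
    u′≡ = trans (sym (leaves-⇒ e)) (proj₂ (graded u))
    t′≡ : leaves t′ ≡ suc (ℕ.pred (leaves t))
    t′≡ = trans (sym (leaves-⇒ d)) (proj₂ (graded t))
  ⇒-sound (⊣∘₁⊢ a b t u v) p q = reindex-Q p q (plug-cong t u v (⊣∘₁⊢-rule a b))
  ⇒-sound (⊢∘₁⊢ a b t u v) p q = reindex-Q p q (plug-cong t u v (⊢∘₁⊢-rule a b))
  ⇒-sound (⊢∘₁⊣ a b t u v) p q = reindex-Q p q (plug-cong t u v (⊢∘₁⊣-rule a b))
  ⇒-sound (⊣∘₂⊣ a b t u v) p q = reindex-Q p q (plug-cong t u v (⊣∘₂⊣-rule a b))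
  ⇒-sound (⊣∘₂⊢ a b t u v) p q = reindex-Q p q (plug-cong t u v (⊣∘₂⊢-rule a b))

  -- 0 is a junk value, never taken on the word of a tree.
  section : ∀ {k} → Word′ k → F.⟦ k ⟧
  section {k} (w , _) with leaves (normal (decode w)) ℕ.≟ suc k
  ... | yes p = basis (normal (decode w) , p)
  ... | no  _ = F.0ᴹ

  section-wordOf : ∀ {k} (x : Tree′ k) → basis x Q.≈ᴹ section (wordOf x)
  section-wordOf {k} (t , p) = go
    where
    -- The word of `t` determines `pointed t`, hence the normal form of `t`.
    t⇒ : t ⇒ normal (decode (eval t))
    t⇒ = subst (λ x → t ⇒ normal x)
      (sym (trans (cong decode (eval-pointed t)) (decode-encode (pointed t)))) (normalise t)
    go : basis (t , p) Q.≈ᴹ section (wordOf (t , p))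
    go with leaves (normal (decode (eval t))) ℕ.≟ suc k
    ... | yes q = ⇒-sound t⇒ p q
    -- Rewriting keeps the number of leaves, so the junk case is absurd.
    ... | no ¬q = contradiction (trans (sym (leaves-⇒ t⇒)) p) ¬q

  -- The linear extension of `section` is a left inverse of `φ` modulo the relations: by linearity
  -- it suffices to check basis trees.
  φ-injective : ∀ {k} {u v : F.⟦ k ⟧} → φ k u W.≈ᴹ φ k v → u Q.≈ᴹ v
  φ-injective {k} {u} {v} p = begin
    u           ≈⟨ section-φ u ⟩
    σ (φ k u)   ≈⟨ extend-cong R (Q.component k) section p ⟩
    σ (φ k v)   ≈⟨ section-φ v ⟨
    v           ∎
    where
    open SetoidReasoning (Module.≈ᴹ-setoid (Q.component k))
    σ : W.⟦ k ⟧ → F.⟦ k ⟧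
    σ = extend R (Q.component k) section
    section-φ : ∀ u → u Q.≈ᴹ σ (φ k u)
    section-φ = extend-unique R (Q.component k) (quotient-linear k)
      (∘-linear R (F.component k) (W.component k) (Q.component k)
        (extend-linear R (Q.component k) section) (φ-linear k))
      section-wordOf

  -- The isomorphism

  presentation : Presentation R (Dias R γ) (𝔊 γ) (wordᴰ R γ) (Relation R γ)
  presentation = record
    { iso = record
      { to = λ k u → φ k u , φ-generated u
      ; isIso = λ k → record
        { isModuleMonomorphism = record
          { isModuleHomomorphism = record
            { isBimoduleHomomorphism = record
              { +ᴹ-isGroupHomomorphism = record
                { isMonoidHomomorphism = record
                  { isMagmaHomomorphism = record
                    { isRelHomomorphism = record { cong = φ-cong }
                    ; homo = λ _ _ → ≋-refl }
                  ; ε-homo = ≋-refl }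
                ; ⁻¹-homo = λ _ → ≋-refl }
              ; *ₗ-homo = λ _ _ → ≋-refl
              ; *ᵣ-homo = λ _ _ → ≋-refl } }
          ; injective = φ-injective }
        ; surjective = λ (w , g) → let (u , p) = φ-surjective g in
            u , λ q → ≋-trans (φ-cong q) p }
      ; one-homo = basis-≡ refl
      ; ∘-homo = φ-∘ }
    ; iso-corolla = φ-corolla }

proposition2p3p8 : ∀ {c ℓ₁ ℓ₂} (K : HeytingField c ℓ₁ ℓ₂) →
    CharacteristicZero (fieldRing K) → (γ : ℕ) →
    Presentation (fieldRing K) (Dias (fieldRing K) γ) (𝔊 γ) (wordᴰ (fieldRing K) γ)
    (Relation (fieldRing K) γ)
proposition2p3p8 K _ γ = DiasPresentation.presentation (fieldRing K) γ
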